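{- Let ${\sf SimpNormal}$ be the following formula about an infinite binary sequence $x\in 2^\omega$, expressing that $x$ is simply normal in base $2$: $$\forall k\ \exists s\ \forall t\ge s.\ \left|{\sf Freq}_1(x\upharpoonright t)-\tfrac12\right|\le\tfrac1{k+1}.$$ Then ${\sf SimpNormal}$ is $\forall^{\downarrow}\forall^\infty$-dicomplete.
   Context: For a binary string $\sigma$ of length $n\geq 1$, ${\sf Freq}_1(\sigma)=\#\{k<n:\sigma(k)=1\}/n$ (the value for the empty string is immaterial), and $x\upharpoonright t$ is the initial segment of $x$ of length $t$. Quantifiers range over $\omega$. $\exists^\infty n\,\varphi(n)$ means $\forall m\exists n\ge m\,\varphi(n)$ and $\forall^\infty n\,\varphi(n)$ means $\exists m\forall n\ge m\,\varphi(n)$. A quantifier-pattern is a finite string $\bar{\mathsf Q}=\mathsf Q_0\dots\mathsf Q_\ell$ over $\{\exists,\forall,\exists^\infty,\forall^\infty\}$. A $\bar{\mathsf Q}$-formula is $\varphi(\bar x)\equiv\mathsf Q_0n_0\dots\mathsf Q_\ell n_\ell\,\theta(n_0,\dots,n_\ell,\bar x)$ with $\theta$ a bounded formula. The instance $\bar x$ is a tuple of natural numbers and/or total computable functions (computable elements of $\omega^\omega$; for ${\sf SimpNormal}$, computable elements of $2^\omega$). Spaces such as $\omega\times\omega^\omega$, $(\omega^\omega)^\omega$, $\omega^{\omega\times\omega}$ are identified with $\omega^\omega$ by computable pairing. Witnesses: for $\alpha\in\omega^\omega$, $\alpha\Vdash\varphi(\bar x)$ ("$\alpha$ is a witness for $\varphi(\bar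 x)$") is defined by: $\alpha\Vdash\theta(\bar x)$ iff $\alpha=\bar x$ and $\theta(\bar x)$, for bounded $\theta$; $\langle t,\alpha\rangle\Vdash\exists n\varphi(n,\bar x)$ iff $\alpha\Vdash\varphi(t,\bar x)$; $\alpha\Vdash\forall n\varphi(n,\bar x)$ iff $\alpha(n)\Vdash\varphi(n,\bar x)$ for all $n$; $\langle t,\alpha\rangle\Vdash\forall^\infty n\varphi(n,\bar x)$ iff $\alpha(n)\Vdash\varphi(n,\bar x)$ for all $n\ge t$; $\alpha\Vdash\exists^\infty n\varphi(n,\bar x)$ iff for all $n$, writing $\alpha(n)=\langle k,\beta\rangle$, $k\ge n$ and $\beta\Vdash\varphi(k,\bar x)$. Reducibility: $\varphi\le_{\sf m}\psi$ if there are computable functions $\eta,r_-,r_+$ (type-two computable functionals, possibly partial but defined wherever required) such that for every instance $\bar x$: $\varphi(\bar x)$ is true iff $\psi(\eta(\bar x))$ is true; $\alpha\Vdash\varphi(\bar x)$ implies $r_-(\alpha,\bar x)\Vdash\psi(\eta(\bar x))$; $\alpha\Vdash\psi(\eta(\bar x))$ implies $r_+(\alpha,\bar x)\Vdash\varphi(\bar x)$ ($\alpha\in\omega^\omega$ arbitrary). The dual $\varphi^{\sf d}$ of $\mathsf Q_0n_0\dots\mathsf Q_\ell n_\ell\,\theta$ is $\mathsf Q_0^{\sf d}n_0\dots\mathsf Q_\ell^{\sf d}n_\ell\,\neg\theta$, where $\exists^{\sf d}=\forall$, $\forall^{\sf d}=\exists$, $(\exists^\infty)^{\sf d}=\forall^\infty$,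 $(\forall^\infty)^{\sf d}=\exists^\infty$. $\varphi\le_{\sf dm}\psi$ if $\varphi\le_{\sf m}\psi$ and $\varphi^{\sf d}\le_{\sf m}\psi^{\sf d}$ via a common $\eta$ (the $r_\pm$ may differ). A formula $\psi(a,x)$ is descending if $a'\le a$ and $\psi(a,x)$ imply $\psi(a',x)$. A $\forall^{\downarrow}\forall^\infty$-formula is a formula $\forall a\,\psi(a,x)$ where $\psi(a,x)$ is a descending $\forall^\infty$-formula; its dual is the dual as a $\forall\forall^\infty$-formula. A formula is strictly $\forall^{\downarrow}\forall^\infty$-dicomplete if it is a $\forall^{\downarrow}\forall^\infty$-formula and every $\forall^{\downarrow}\forall^\infty$-formula is $\le_{\sf dm}$-reducible to it; it is $\forall^{\downarrow}\forall^\infty$-dicomplete if it is $\equiv_{\sf dm}$-equivalent to a strictly $\forall^{\downarrow}\forall^\infty$-dicomplete formula. -}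

module Defs where

open import Data.Fin.Base using (Fin; toℕ)
open import Data.Fin.Patterns using (1F)
import Data.Fin.Properties as Fin
open import Data.Integer.Base using (+_)
open import Data.List.Base using (List; []; _∷_; map)
open import Data.List.Membership.Propositional using (_∈_)
open import Data.List.Relation.Unary.All using (All; []; _∷_; lookup)
open import Data.Nat.Base using (ℕ; zero; suc; _+_; _*_; _≤_; _<_)
open import Data.Product.Base using (∃; ∃-syntax; _×_; _,_; proj₁)
open import Data.Rational.Base as ℚ using (ℚ; 0ℚ; ½; ∣_∣)
open import Data.Sum.Base using (_⊎_)
open import Data.Vec.Base as Vec using (Vec; []; _∷_; count; tabulate)
open import Data.Vec.Relation.Binary.Pointwise.Inductive using (Pointwise)
open import Function.Base using (_∘_)
open import Function.Bundles using (_⇔_)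
open import Relation.Binary.PropositionalEquality using (_≡_; _≗_)
open import Relation.Nullary.Negation using (¬_)

------------------------------------------------------------------------
-- Type-two computability: Kleene's μ-recursive functions relative to an
-- oracle f ∈ ω^ω.

data Code : ℕ → Set where
  zer    : ∀ {n} → Code n
  succ   : Code 1
  proj   : ∀ {n} → Fin n → Code n
  oracle : Code 1
  comp   : ∀ {m n} → Code m → Vec (Code n) m → Code n
  prec   : ∀ {n} → Code n → Code (2 + n) → Code (suc n)
  mu     : ∀ {n} → Code (suc n) → Code n

infix 4 _⊢_·_⇓_

-- f ⊢ e · xs ⇓ y : with oracle f, the program e halts on xs with value y.
data _⊢_·_⇓_ (f : ℕ → ℕ) : ∀ {n} → Code n → Vec ℕ n → ℕ → Set where
  zer⇓      : ∀ {n} {xs : Vec ℕ n} → f ⊢ zer · xs ⇓ 0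
  succ⇓     : ∀ {x} → f ⊢ succ · x ∷ [] ⇓ suc x
  proj⇓     : ∀ {n} {xs : Vec ℕ n} i → f ⊢ proj i · xs ⇓ Vec.lookup xs i
  oracle⇓   : ∀ {x} → f ⊢ oracle · x ∷ [] ⇓ f x
  comp⇓     : ∀ {m n} {g : Code m} {hs : Vec (Code n) m} {xs ys z} →
              Pointwise (λ h y → f ⊢ h · xs ⇓ y) hs ys →
              f ⊢ g · ys ⇓ z →
              f ⊢ comp g hs · xs ⇓ z
  prec-zero⇓ : ∀ {n} {g : Code n} {h xs y} →
              f ⊢ g · xs ⇓ y →
              f ⊢ prec g h · 0 ∷ xs ⇓ y
  prec-suc⇓ : ∀ {n} {g : Code n} {h xs k y z} →
              f ⊢ prec g h · k ∷ xs ⇓ y →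
              f ⊢ h · k ∷ y ∷ xs ⇓ z →
              f ⊢ prec g h · suc k ∷ xs ⇓ z
  mu⇓       : ∀ {n} {g : Code (suc n)} {xs k} →
              f ⊢ g · k ∷ xs ⇓ 0 →
              (∀ j → j < k → ∃[ y ] f ⊢ g · j ∷ xs ⇓ suc y) →
              f ⊢ mu g · xs ⇓ k

-- The partial functional ω^ω ⇀ ω^ω given by e is defined at f with value g.
-- The value g is determined only up to ≗.
Computes : Code 1 → (ℕ → ℕ) → (ℕ → ℕ) → Set
Computes e f g = ∀ n → f ⊢ e · n ∷ [] ⇓ g n

Computable : (ℕ → ℕ) → Set
Computable f = ∃[ e ] Computes e (λ _ → 0) f

------------------------------------------------------------------------
-- Identification of product spaces with ω^ω

-- ω × ω^ω : ⟨t, α⟩ is cons t α; its components are head and tail.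
cons : ℕ → (ℕ → ℕ) → (ℕ → ℕ)
cons t α zero    = t
cons t α (suc n) = α n

head : (ℕ → ℕ) → ℕ
head α = α 0

tail : (ℕ → ℕ) → (ℕ → ℕ)
tail α = α ∘ suc

-- ω^ω × ω^ω : f ⊕ g = f 0, g 0, f 1, g 1, …
infixr 5 _⊕_
_⊕_ : (ℕ → ℕ) → (ℕ → ℕ) → (ℕ → ℕ)
(f ⊕ g) zero    = f 0
(f ⊕ g) (suc n) = (g ⊕ tail f) n

triangular : ℕ → ℕ
triangular zero    = 0
triangular (suc n) = suc n + triangular n

-- Cantor's bijection ω × ω → ω.
pair : ℕ → ℕ → ℕ
pair m n = triangular (m + n) + n

-- (ω^ω)^ω : row α n is the n-th entry α(n) ∈ ω^ω.
row : (ℕ → ℕ) → ℕ → (ℕ → ℕ)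
row α n m = α (pair n m)

------------------------------------------------------------------------
-- Instances

-- ω, ω^ω and 2^ω.
data Sort : Set where
  num fun bin : Sort

⟦_⟧ˢ : Sort → Set
⟦ num ⟧ˢ = ℕ
⟦ fun ⟧ˢ = ℕ → ℕ
⟦ bin ⟧ˢ = ℕ → Fin 2

Tuple : List Sort → Set
Tuple = All ⟦_⟧ˢ

encode : ∀ {Γ} → Tuple Γ → (ℕ → ℕ)
encode []                   = λ _ → 0
encode (_∷_ {x = num} n xs) = cons n (encode xs)
encode (_∷_ {x = fun} f xs) = f ⊕ encode xs
encode (_∷_ {x = bin} f xs) = (toℕ ∘ f) ⊕ encode xs

Instance : List Sort → Set
Instance Γ = ∃[ x ] Computable (encode {Γ} x)

------------------------------------------------------------------------
-- Formulas

data Quantifier : Set where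
  ∃′ ∀′ ∃∞ ∀∞ : Quantifier

-- Formula Q Γ : formulas with quantifier-pattern Q and free variables Γ.
-- The quantified number is put in front of the instance, so the matrix of
-- Q₀n₀ … Q_ℓ n_ℓ θ is a predicate of the tuple (n_ℓ , … , n₀ , x̄).
-- That the matrix is a bounded formula is the separate condition
-- BoundedMatrix below.
data Formula : List Quantifier → List Sort → Set₁ where
  matrix : ∀ {Γ} → (Tuple Γ → Set) → Formula [] Γ
  quant  : ∀ {Q Γ} (q : Quantifier) → Formula Q (num ∷ Γ) → Formula (q ∷ Q) Γ

True : ∀ {Q Γ} → Formula Q Γ → Tuple Γ → Set
True (matrix θ)   x = θ x
True (quant ∃′ φ) x = ∃[ n ] True φ (n ∷ x)
True (quant ∀′ φ) x = ∀ n → True φ (n ∷ x)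
True (quant ∃∞ φ) x = ∀ m → ∃[ n ] m ≤ n × True φ (n ∷ x)
True (quant ∀∞ φ) x = ∃[ m ] (∀ n → m ≤ n → True φ (n ∷ x))

infix 4 _⊩_at_

-- α ⊩ φ at x : α is a witness for φ(x).
_⊩_at_ : ∀ {Q Γ} → (ℕ → ℕ) → Formula Q Γ → Tuple Γ → Set
α ⊩ matrix θ   at x = α ≗ encode x × θ x
α ⊩ quant ∃′ φ at x = tail α ⊩ φ at (head α ∷ x)
α ⊩ quant ∀′ φ at x = ∀ n → row α n ⊩ φ at (n ∷ x)
α ⊩ quant ∃∞ φ at x =
  ∀ n → n ≤ head (row α n) × tail (row α n) ⊩ φ at (head (row α n) ∷ x)
α ⊩ quant ∀∞ φ at x = ∀ n → head α ≤ n → row (tail α) n ⊩ φ at (n ∷ x)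

dualQ : Quantifier → Quantifier
dualQ ∃′ = ∀′
dualQ ∀′ = ∃′
dualQ ∃∞ = ∀∞
dualQ ∀∞ = ∃∞

dual : ∀ {Q Γ} → Formula Q Γ → Formula (map dualQ Q) Γ
dual (matrix θ)  = matrix (λ x → ¬ θ x)
dual (quant q φ) = quant (dualQ q) (dual φ)

------------------------------------------------------------------------
-- Bounded formulas of arithmetic with number, function and set parameters

-- The operator rec makes all primitive recursive functions (relative to the
-- function parameters) available as terms; quantities such as Freq₁(x ↾ t)
-- need this.  In rec t a b, the term b sees the previous value and the
-- recursion index as its two newest variables, in this order.
data Term (Γ : List Sort) : Set where
  var       : num ∈ Γ → Term Γ
  appᶠ      : fun ∈ Γ → Term Γ → Term Γ
  appᵇ      : bin ∈ Γ → Term Γ → Term Γ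
  zeroᵗ     : Term Γ
  sucᵗ      : Term Γ → Term Γ
  _+ᵗ_ _*ᵗ_ : Term Γ → Term Γ → Term Γ
  rec       : Term Γ → Term Γ → Term (num ∷ num ∷ Γ) → Term Γ

primRec : ℕ → (ℕ → ℕ → ℕ) → ℕ → ℕ
primRec a b zero    = a
primRec a b (suc n) = b (primRec a b n) n

⟦_⟧ᵗ : ∀ {Γ} → Term Γ → Tuple Γ → ℕ
⟦ var i ⟧ᵗ     x = lookup x i
⟦ appᶠ i t ⟧ᵗ  x = lookup x i (⟦ t ⟧ᵗ x)
⟦ appᵇ i t ⟧ᵗ  x = toℕ (lookup x i (⟦ t ⟧ᵗ x))
⟦ zeroᵗ ⟧ᵗ     x = 0
⟦ sucᵗ t ⟧ᵗ    x = suc (⟦ t ⟧ᵗ x)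
⟦ t +ᵗ u ⟧ᵗ    x = ⟦ t ⟧ᵗ x + ⟦ u ⟧ᵗ x
⟦ t *ᵗ u ⟧ᵗ    x = ⟦ t ⟧ᵗ x * ⟦ u ⟧ᵗ x
⟦ rec t a b ⟧ᵗ x = primRec (⟦ a ⟧ᵗ x) (λ y n → ⟦ b ⟧ᵗ (y ∷ n ∷ x)) (⟦ t ⟧ᵗ x)

data BoundedFormula (Γ : List Sort) : Set where
  _≈ᵇ_ _≺ᵇ_ : Term Γ → Term Γ → BoundedFormula Γ
  ¬ᵇ_       : BoundedFormula Γ → BoundedFormula Γ
  _∧ᵇ_ _∨ᵇ_ : BoundedFormula Γ → BoundedFormula Γ → BoundedFormula Γ
  ∀<_∙_     : Term Γ → BoundedFormula (num ∷ Γ) → BoundedFormula Γ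
  ∃<_∙_     : Term Γ → BoundedFormula (num ∷ Γ) → BoundedFormula Γ

⟦_⟧ᵇ : ∀ {Γ} → BoundedFormula Γ → Tuple Γ → Set
⟦ t ≈ᵇ u ⟧ᵇ   x = ⟦ t ⟧ᵗ x ≡ ⟦ u ⟧ᵗ x
⟦ t ≺ᵇ u ⟧ᵇ   x = ⟦ t ⟧ᵗ x < ⟦ u ⟧ᵗ x
⟦ ¬ᵇ A ⟧ᵇ     x = ¬ ⟦ A ⟧ᵇ x
⟦ A ∧ᵇ B ⟧ᵇ   x = ⟦ A ⟧ᵇ x × ⟦ B ⟧ᵇ x
⟦ A ∨ᵇ B ⟧ᵇ   x = ⟦ A ⟧ᵇ x ⊎ ⟦ B ⟧ᵇ x
⟦ ∀< t ∙ A ⟧ᵇ x = ∀ n → n < ⟦ t ⟧ᵗ x → ⟦ A ⟧ᵇ (n ∷ x)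
⟦ ∃< t ∙ A ⟧ᵇ x = ∃[ n ] n < ⟦ t ⟧ᵗ x × ⟦ A ⟧ᵇ (n ∷ x)

BoundedMatrix : ∀ {Q Γ} → Formula Q Γ → Set
BoundedMatrix (matrix θ)  = ∃[ A ] (∀ x → θ x ⇔ ⟦ A ⟧ᵇ x)
BoundedMatrix (quant q φ) = BoundedMatrix φ

------------------------------------------------------------------------
-- Reducibility

record ComputableMap (Γ Δ : List Sort) : Set where
  field
    apply  : Instance Γ → Instance Δ
    code   : Code 1
    tracks : ∀ x → Computes code (encode (proj₁ x)) (encode (proj₁ (apply x)))

-- φ ≤ₘ ψ via η.
record ReducesVia {Q R Γ Δ} (η : ComputableMap Γ Δ)
                  (φ : Formula Q Γ) (ψ : Formula R Δ) : Set where
  open ComputableMap η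
  field
    truth : ∀ x → True φ (proj₁ x) ⇔ True ψ (proj₁ (apply x))
    r₋ r₊ : Code 1
    r₋-witness : ∀ x α → α ⊩ φ at proj₁ x →
                 ∃[ β ] Computes r₋ (α ⊕ encode (proj₁ x)) β ×
                        β ⊩ ψ at proj₁ (apply x)
    r₊-witness : ∀ x α → α ⊩ ψ at proj₁ (apply x) →
                 ∃[ β ] Computes r₊ (α ⊕ encode (proj₁ x)) β ×
                        β ⊩ φ at proj₁ x

infix 4 _≤ₘ_ _≤dm_ _≡dm_

_≤ₘ_ : ∀ {Q R Γ Δ} → Formula Q Γ → Formula R Δ → Set
φ ≤ₘ ψ = ∃[ η ] ReducesVia η φ ψ

_≤dm_ : ∀ {Q R Γ Δ} → Formula Q Γ → Formula R Δ → Set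
φ ≤dm ψ = ∃[ η ] ReducesVia η φ ψ × ReducesVia η (dual φ) (dual ψ)

_≡dm_ : ∀ {Q R Γ Δ} → Formula Q Γ → Formula R Δ → Set
φ ≡dm ψ = φ ≤dm ψ × ψ ≤dm φ

------------------------------------------------------------------------
-- ∀↓∀∞-dicompleteness

Descending : ∀ {Q Γ} → Formula Q (num ∷ Γ) → Set
Descending {Γ = Γ} ψ = ∀ (x : Instance Γ) a a′ → a′ ≤ a →
                       True ψ (a ∷ proj₁ x) → True ψ (a′ ∷ proj₁ x)

∀∀∞-Formula : List Sort → Set₁
∀∀∞-Formula = Formula (∀′ ∷ ∀∞ ∷ [])

Is∀↓∀∞ : ∀ {Γ} → ∀∀∞-Formula Γ → Set
Is∀↓∀∞ φ@(quant .∀′ ψ) = BoundedMatrix φ × Descending ψ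

Strictly∀↓∀∞-Dicomplete : ∀ {Γ} → ∀∀∞-Formula Γ → Set₁
Strictly∀↓∀∞-Dicomplete φ =
  Is∀↓∀∞ φ × (∀ {Δ} (χ : ∀∀∞-Formula Δ) → Is∀↓∀∞ χ → χ ≤dm φ)

∀↓∀∞-Dicomplete : ∀ {Q Γ} → Formula Q Γ → Set₁
∀↓∀∞-Dicomplete φ =
  ∃[ Δ ] ∃[ ψ ] Strictly∀↓∀∞-Dicomplete {Δ} ψ × φ ≡dm ψ

------------------------------------------------------------------------
-- Simple normality in base 2

infix 8 _↾_
_↾_ : (ℕ → Fin 2) → (t : ℕ) → Vec (Fin 2) t
x ↾ t = tabulate (x ∘ toℕ)

Freq₁ : ∀ {n} → Vec (Fin 2) n → ℚ
Freq₁ {zero}  σ = 0ℚ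
Freq₁ {suc n} σ = + count (Fin._≟ 1F) σ ℚ./ suc n

-- ∃s ∀t≥s is the quantifier ∀∞ t.
SimpNormal : ∀∀∞-Formula (bin ∷ [])
SimpNormal = quant ∀′ (quant ∀∞ (matrix λ { (t ∷ k ∷ x ∷ []) →
  ∣ Freq₁ (x ↾ t) ℚ.- ½ ∣ ℚ.≤ + 1 ℚ./ suc k }))

{-# OPTIONS --safe #-}

-- SimpNormal is itself descending, so it suffices to reduce every
-- χ(x) = ∀a ∀∞n θ(n,a,x) with descending ∀∞n θ to it.  From x we build bits
-- whose deviation from balance near length 2^(n+1) is of order 2^(-a), for the
-- least a ≤ n with ¬θ(n,a,x), and negligible if there is none.  Then
-- "∀∞n θ(n,a,x) for all a ≤ k" bounds the deviation eventually by 1/(k+1), and a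
-- failure ¬θ(n,a,x) with a ≤ n makes it exceed 1/(4·2^a + 3) at some length
-- beyond n, so moduli and recurrences translate.  Only one translation is not
-- uniform: recurrent deviations above 1/(k+1) come from failures of some a ≤ k,
-- without telling which.  Descent shows that k itself then fails infinitely
-- often, and those failures are found by unbounded search.
module Submission where

open import Axiom.ExcludedMiddle using (ExcludedMiddle)
open import Level using (0ℓ)
open import Defs

open import Data.Fin.Base using (Fin; zero; suc; toℕ)
open import Data.Fin.Patterns using (0F; 1F; 2F)
import Data.Fin.Properties as Fin
import Data.Integer.Base as ℤ
open ℤ using (_⊖_)
import Data.Integer.Properties as ℤ
open import Data.List.Base using (List; []; _∷_)
open import Data.List.Membership.Propositional using (_∈_)
open import Data.List.Relation.Unary.All as All using ([]; _∷_)
open import Data.List.Relation.Unary.Any using (here; there)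
open import Data.Nat.Base
open import Data.Nat.Properties
open import Data.Nat.Tactic.RingSolver using (solve-∀)
open import Data.Product.Base using (∃; ∃-syntax; _×_; _,_; proj₁; proj₂)
import Data.Rational.Base as ℚ
open ℚ using (½; toℚᵘ)
import Data.Rational.Properties as ℚ
open import Data.Rational.Unnormalised.Base as ℚᵘ using (mkℚᵘ; *≤*)
import Data.Rational.Unnormalised.Properties as ℚᵘ
open import Data.Sum.Base as Sum using (inj₁; inj₂)
open import Data.Unit.Base using (⊤)
open import Data.Vec.Base as Vec using (Vec; []; _∷_; lookup; tabulate)
import Data.Vec.Functional as Fun
open import Data.Vec.Properties using (tabulate∘lookup)
open import Data.Vec.Relation.Binary.Pointwise.Inductive as Pointwise using (Pointwise; []; _∷_)
open import Function.Base using (_∘_)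
open import Function.Bundles using (_⇔_; mk⇔; Equivalence)
open import Relation.Binary.PropositionalEquality
open import Relation.Nullary using (¬_; contradiction; yes; no)

private variable
  I I′ : Set
  k l m : ℕ

-- Oracle substitution

substOracle  : Code 1 → Code k → Code k
substOracles : Code 1 → Vec (Code k) m → Vec (Code k) m
substOracle d zer         = zer
substOracle d succ        = succ
substOracle d (proj i)    = proj i
substOracle d oracle      = d
substOracle d (comp g hs) = comp (substOracle d g) (substOracles d hs)
substOracle d (prec g h)  = prec (substOracle d g) (substOracle d h)
substOracle d (mu g)      = mu (substOracle d g)
substOracles d []         = []
substOracles d (h ∷ hs)   = substOracle d h ∷ substOracles d hs

module _ {f g : ℕ → ℕ} {d : Code 1} (d-computes : Computes d f g) where

  substOracle⇓ : ∀ {e : Code k} {xs y} → g ⊢ e · xs ⇓ y → f ⊢ substOracle d e · xs ⇓ y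
  substOracles⇓ : ∀ {hs : Vec (Code k) m} {xs ys} →
                  Pointwise (λ h y → g ⊢ h · xs ⇓ y) hs ys →
                  Pointwise (λ h y → f ⊢ h · xs ⇓ y) (substOracles d hs) ys
  substOracle⇓ zer⇓              = zer⇓
  substOracle⇓ succ⇓             = succ⇓
  substOracle⇓ (proj⇓ i)         = proj⇓ i
  substOracle⇓ oracle⇓           = d-computes _
  substOracle⇓ (comp⇓ hs⇓ g⇓)    = comp⇓ (substOracles⇓ hs⇓) (substOracle⇓ g⇓)
  substOracle⇓ (prec-zero⇓ g⇓)   = prec-zero⇓ (substOracle⇓ g⇓)
  substOracle⇓ (prec-suc⇓ p⇓ h⇓) = prec-suc⇓ (substOracle⇓ p⇓) (substOracle⇓ h⇓)
  substOracle⇓ (mu⇓ g⇓ below)    = mu⇓ (substOracle⇓ g⇓) λ j j<k →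
    proj₁ (below j j<k) , substOracle⇓ (proj₂ (below j j<k))
  substOracles⇓ []               = []
  substOracles⇓ (h⇓ ∷ hs⇓)       = substOracle⇓ h⇓ ∷ substOracles⇓ hs⇓

-- Uniformly computable families of functions

-- Rec ι F : one program computes every F i, with oracle ι i.  Partial
-- functionals are covered by restricting the index set I to their domain.
record Rec (ι : I → ℕ → ℕ) (F : I → Vec ℕ k → ℕ) : Set where
  constructor _,_
  field
    code    : Code k
    correct : ∀ i v → ι i ⊢ code · v ⇓ F i v

-- Given by its action on argument programs of every arity, so that a function can be applied in any
-- variable context; `fun₁` obtains the action from a single unary program.
record Fun₁ (ι : I → ℕ → ℕ) (f : I → ℕ → ℕ) : Set where
  infixr 9 _$ʳ_
  field
    _$ʳ_ : {G : I → Vec ℕ k → ℕ} → Rec ι G → Rec ι (λ i v → f i (G i v))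
open Fun₁

module _ {ι : I → ℕ → ℕ} where

  Rec-cong : {F G : I → Vec ℕ k → ℕ} → (∀ i v → F i v ≡ G i v) → Rec ι F → Rec ι G
  Rec-cong F≗G (e , e⇓) = e , λ i v → subst (ι i ⊢ e · v ⇓_) (F≗G i v) (e⇓ i v)

  Fun₁-cong : {f g : I → ℕ → ℕ} → (∀ i n → f i n ≡ g i n) → Fun₁ ι f → Fun₁ ι g
  Fun₁-cong f≗g f ._$ʳ_ G = Rec-cong (λ i v → f≗g i _) (f $ʳ G)

  compʳ : {F : I → Vec ℕ m → ℕ} {Gs : I → Vec ℕ k → Vec ℕ m} → Rec ι F →
          (∀ j → Rec ι (λ i v → lookup (Gs i v) j)) → Rec ι (λ i v → F i (Gs i v))
  compʳ {Gs = Gs} (e , e⇓) es = comp e (tabulate (Rec.code ∘ es)) , λ i v →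
    comp⇓ (subst (Pointwise _ _) (tabulate∘lookup (Gs i v))
            (Pointwise.tabulate⁺ (λ j → Rec.correct (es j) i v)))
          (e⇓ i (Gs i v))

  fun₁ : {f : I → ℕ → ℕ} → Rec ι (λ i v → f i (lookup {n = 1} v 0F)) → Fun₁ ι f
  fun₁ f ._$ʳ_ G = compʳ {Gs = λ i v → _ ∷ []} f λ { 0F → G }

  arg : (j : Fin k) → Rec ι (λ i v → lookup v j)
  arg j = proj j , λ i v → proj⇓ j

  weaken : {F : I → Vec ℕ k → ℕ} → Rec ι F → Rec ι (λ i v → F i (Vec.tail v))
  weaken F = compʳ F λ j → Rec-cong (λ { i (_ ∷ _) → refl }) (arg (suc j))

  zeroʳ : Rec {k = k} ι (λ _ _ → 0)
  zeroʳ = zer , λ _ _ → zer⇓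

  oracleʳ : Fun₁ ι ι
  oracleʳ = fun₁ (oracle , λ { i (_ ∷ []) → oracle⇓ })

  sucʳ_ : {F : I → Vec ℕ k → ℕ} → Rec ι F → Rec ι (λ i v → suc (F i v))
  sucʳ_ = fun₁ (succ , λ { i (_ ∷ []) → succ⇓ }) $ʳ_

  recʳ : {T A : I → Vec ℕ k → ℕ} {B : I → Vec ℕ (2 + k) → ℕ} → Rec ι T → Rec ι A → Rec ι B →
         Rec ι (λ i v → primRec (A i v) (λ y n → B i (n ∷ y ∷ v)) (T i v))
  recʳ {T = T} {A} {B} T′ (a , a⇓) (b , b⇓) =
    compʳ {F = F} {Gs = λ i v → T i v ∷ v}
      (prec a b , λ { i (n ∷ v) → loop i v n })
      λ { zero → T′ ; (suc j) → arg j }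
    where
    F : I → Vec ℕ _ → ℕ
    F i (t ∷ v) = primRec (A i v) (λ y n → B i (n ∷ y ∷ v)) t
    loop : ∀ i v n → ι i ⊢ prec a b · n ∷ v ⇓ F i (n ∷ v)
    loop i v zero    = prec-zero⇓ (a⇓ i v)
    loop i v (suc n) = prec-suc⇓ (loop i v n) (b⇓ i (n ∷ F i (n ∷ v) ∷ v))

  -- The result `F` of the search is given beforehand as the least zero. Hence the proof that the
  -- search ends may be nonconstructive although the program is a plain `mu`.
  muʳ : {P : I → Vec ℕ (suc k) → ℕ} {F : I → Vec ℕ k → ℕ} → Rec ι P →
        (∀ i v → P i (F i v ∷ v) ≡ 0) → (∀ i v j → j < F i v → P i (j ∷ v) ≢ 0) → Rec ι F
  muʳ {P = P} (p , p⇓) zeroAt nonzeroBelow = mu p , λ i v →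
    mu⇓ (subst (ι i ⊢ p · _ ⇓_) (zeroAt i v) (p⇓ i _)) λ j j< →
      let instance _ = ≢-nonZero (nonzeroBelow i v j j<) in
      pred (P i (j ∷ v)) , subst (ι i ⊢ p · _ ⇓_) (sym (suc-pred _)) (p⇓ i _)

-- Composition of functionals: each call of the oracle `ι′ (h i)` is replaced by the program that
-- computes it from `ι i`.
rebase : {ι : I → ℕ → ℕ} {ι′ : I′ → ℕ → ℕ} {h : I → I′} {F : I′ → Vec ℕ k → ℕ} →
         Fun₁ ι (λ i → ι′ (h i)) → Rec ι′ F → Rec ι (λ i v → F (h i) v)
rebase {h = h} f (e , e⇓) =
  substOracle (Rec.code f′) e ,
  λ i v → substOracle⇓ (λ n → Rec.correct f′ i (n ∷ [])) (e⇓ (h i) v)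
  where
  f′ = f $ʳ arg {k = 1} 0F

-- Primitive recursive arithmetic

sum< product< max< : (ℕ → ℕ) → ℕ → ℕ
sum< f     = primRec 0 (λ y n → y + f n)
product< f = primRec 1 (λ y n → y * f n)
max< f     = primRec 0 (λ y n → y ⊔ f n)

module _ {ι : I → ℕ → ℕ} where

  infixl 6 _+ʳ_ _∸ʳ_ _⊔ʳ_
  infixl 7 _*ʳ_ _⊓ʳ_
  infixr 8 2^ʳ_

  _+ʳ_ : {F G : I → Vec ℕ k → ℕ} → Rec ι F → Rec ι G → Rec ι (λ i v → F i v + G i v)
  _+ʳ_ {F = f} {g} F G = Rec-cong (λ i v → eq (f i v) (g i v)) (recʳ F G (sucʳ arg 1F))
    where
    eq : ∀ m n → primRec n (λ y _ → suc y) m ≡ m + n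
    eq zero    n = refl
    eq (suc m) n = cong suc (eq m n)

  _*ʳ_ : {F G : I → Vec ℕ k → ℕ} → Rec ι F → Rec ι G → Rec ι (λ i v → F i v * G i v)
  _*ʳ_ {F = f} {g} F G = Rec-cong (λ i v → eq (f i v) (g i v)) (recʳ F zeroʳ (weaken (weaken G) +ʳ arg 1F))
    where
    eq : ∀ m n → primRec 0 (λ y _ → n + y) m ≡ m * n
    eq zero    n = refl
    eq (suc m) n = cong (n +_) (eq m n)

  predʳ : {F : I → Vec ℕ k → ℕ} → Rec ι F → Rec ι (λ i v → pred (F i v))
  predʳ {F = f} F = Rec-cong (λ i v → eq (f i v)) (recʳ F zeroʳ (arg 0F))
    where
    eq : ∀ m → primRec 0 (λ _ n → n) m ≡ pred m
    eq zero    = refl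
    eq (suc m) = refl

  _∸ʳ_ : {F G : I → Vec ℕ k → ℕ} → Rec ι F → Rec ι G → Rec ι (λ i v → F i v ∸ G i v)
  _∸ʳ_ {F = f} {g} F G = Rec-cong (λ i v → eq (f i v) (g i v)) (recʳ G F (predʳ (arg 1F)))
    where
    eq : ∀ m n → primRec m (λ y _ → pred y) n ≡ m ∸ n
    eq m zero    = refl
    eq m (suc n) = trans (cong pred (eq m n)) (pred[m∸n]≡m∸[1+n] m n)

  _⊔ʳ_ : {F G : I → Vec ℕ k → ℕ} → Rec ι F → Rec ι G → Rec ι (λ i v → F i v ⊔ G i v)
  _⊔ʳ_ {F = f} {g} F G = Rec-cong (λ i v → eq (f i v) (g i v)) (F +ʳ (G ∸ʳ F))
    where
    eq : ∀ m n → m + (n ∸ m) ≡ m ⊔ n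
    eq zero    n       = refl
    eq (suc m) zero    = +-identityʳ (suc m)
    eq (suc m) (suc n) = cong suc (eq m n)

  _⊓ʳ_ : {F G : I → Vec ℕ k → ℕ} → Rec ι F → Rec ι G → Rec ι (λ i v → F i v ⊓ G i v)
  _⊓ʳ_ {F = f} {g} F G = Rec-cong (λ i v → eq (f i v) (g i v)) (F ∸ʳ (F ∸ʳ G))
    where
    eq : ∀ m n → m ∸ (m ∸ n) ≡ m ⊓ n
    eq zero    n       = 0∸n≡0 (0 ∸ n)
    eq (suc m) zero    = n∸n≡0 m
    eq (suc m) (suc n) = trans (+-∸-assoc 1 (m∸n≤m m n)) (cong suc (eq m n))

  2^ʳ_ : {F : I → Vec ℕ k → ℕ} → Rec ι F → Rec ι (λ i v → 2 ^ F i v)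
  2^ʳ_ {F = f} F = Rec-cong (λ i v → eq (f i v)) (recʳ F (sucʳ zeroʳ) (arg 1F +ʳ (arg 1F +ʳ zeroʳ)))
    where
    eq : ∀ m → primRec 1 (λ y _ → y + (y + 0)) m ≡ 2 ^ m
    eq zero    = refl
    eq (suc m) = cong (2 *_) (eq m)

  ⌊_/2⌋ʳ : {F : I → Vec ℕ k → ℕ} → Rec ι F → Rec ι (λ i v → ⌊ F i v /2⌋)
  -- The floor of half of `suc m` is the ceiling of half of `m`, that is `m ∸ ⌊ m /2⌋`: a recursion
  -- without case distinction.
  ⌊_/2⌋ʳ {F = f} F = Rec-cong (λ i v → eq (f i v)) (recʳ F zeroʳ (arg 0F ∸ʳ arg 1F))
    where
    eq : ∀ m → primRec 0 (λ y n → n ∸ y) m ≡ ⌊ m /2⌋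
    eq zero    = refl
    eq (suc m) = begin
      m ∸ primRec 0 (λ y n → n ∸ y) m     ≡⟨ cong (m ∸_) (eq m) ⟩
      m ∸ ⌊ m /2⌋                         ≡⟨ cong (_∸ ⌊ m /2⌋) (⌊n/2⌋+⌈n/2⌉≡n m) ⟨
      ⌊ m /2⌋ + ⌈ m /2⌉ ∸ ⌊ m /2⌋         ≡⟨ m+n∸m≡n ⌊ m /2⌋ ⌈ m /2⌉ ⟩
      ⌈ m /2⌉                             ∎
      where open ≡-Reasoning

  module _ {F : I → Vec ℕ (suc k) → ℕ} {T : I → Vec ℕ k → ℕ} (F′ : Rec ι F) (T′ : Rec ι T) where

    private
      -- In the body of the recursion the accumulated value stands second, behind the index; it is
      -- skipped.
      F″ : Rec ι (λ i v → F i (lookup v 0F ∷ Vec.tail (Vec.tail v)))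
      F″ = compʳ F′ λ { zero    → arg 0F
                      ; (suc j) → Rec-cong (λ { i (_ ∷ _ ∷ _) → refl }) (arg (suc (suc j))) }

    sumʳ : Rec ι (λ i v → sum< (λ n → F i (n ∷ v)) (T i v))
    sumʳ = recʳ T′ zeroʳ (arg 1F +ʳ F″)

    productʳ : Rec ι (λ i v → product< (λ n → F i (n ∷ v)) (T i v))
    productʳ = recʳ T′ (sucʳ zeroʳ) (arg 1F *ʳ F″)

    maxʳ : Rec ι (λ i v → max< (λ n → F i (n ∷ v)) (T i v))
    maxʳ = recʳ T′ zeroʳ (arg 1F ⊔ʳ F″)

-- Coding of pairs and of product spaces

⊕-even : ∀ f g n → (f ⊕ g) (n + n) ≡ f n
⊕-even f g zero    = refl
⊕-even f g (suc n) rewrite +-suc n n = ⊕-even (tail f) (tail g) n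

⊕-odd : ∀ f g n → (f ⊕ g) (suc (n + n)) ≡ g n
⊕-odd f g n = ⊕-even g (tail f) n

odd? : ℕ → ℕ
odd? n = n ∸ (⌊ n /2⌋ + ⌊ n /2⌋)

-- `odd? n` is 0 or 1, so the sum selects one of its summands; this turns the case distinction on
-- parity into arithmetic.
⊕-cases : ∀ f g n → (1 ∸ odd? n) * f ⌊ n /2⌋ + odd? n * g ⌊ n /2⌋ ≡ (f ⊕ g) n
⊕-cases f g zero          = trans (+-identityʳ _) (+-identityʳ _)
⊕-cases f g (suc zero)    = +-identityʳ _
⊕-cases f g (suc (suc n)) rewrite +-suc ⌊ n /2⌋ ⌊ n /2⌋ = ⊕-cases (tail f) (tail g) n

-- The index `d` with `triangular d ≤ p < triangular (suc d)`. The increment is 1 exactly when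
-- `suc p` has reached `triangular (suc d)`.
diagonal : ℕ → ℕ
diagonal = primRec 0 (λ d p → d + (1 ∸ (triangular (suc d) ∸ suc p)))

π₁ π₂ : ℕ → ℕ
π₂ p = p ∸ triangular (diagonal p)
π₁ p = diagonal p ∸ π₂ p

triangular-mono : ∀ {m n} → m ≤ n → triangular m ≤ triangular n
triangular-mono z≤n       = z≤n
triangular-mono (s≤s m≤n) = s≤s (+-mono-≤ m≤n (triangular-mono m≤n))

diagonal-spec : ∀ p → triangular (diagonal p) ≤ p × p < triangular (suc (diagonal p))
diagonal-spec zero    = z≤n , s≤s z≤n
diagonal-spec (suc p) with diagonal p | diagonal-spec p | ≤-total (triangular (suc (diagonal p))) (suc p)
... | d | lower , upper | inj₁ t≤p rewrite m≤n⇒m∸n≡0 t≤p | +-comm d 1 =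
  t≤p , s≤s (≤-trans upper (m≤n+m _ (suc d)))
... | d | lower , upper | inj₂ p≤t with m≤n⇒m<n∨m≡n p≤t
...   | inj₁ p<t rewrite m≤n⇒m∸n≡0 (m<n⇒0<n∸m p<t) | +-identityʳ d = m≤n⇒m≤1+n lower , p<t
...   | inj₂ p≡t rewrite m≤n⇒m∸n≡0 (≤-reflexive (sym p≡t)) | +-comm d 1 =
  ≤-reflexive (sym p≡t) , s≤s (≤-trans upper (m≤n+m _ (suc d)))

-- Both indices enclose `pair m n` between consecutive triangular numbers, and by monotonicity only
-- one index can do so.
diagonal-pair : ∀ m n → diagonal (pair m n) ≡ m + n
diagonal-pair m n = ≤-antisym
  (≮⇒≥ λ s<d → <-irrefl refl (begin-strict
    pair m n                    <⟨ pair<triangular ⟩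
    triangular (suc (m + n))    ≤⟨ triangular-mono s<d ⟩
    triangular d                ≤⟨ proj₁ (diagonal-spec (pair m n)) ⟩
    pair m n                    ∎))
  (≮⇒≥ λ d<s → <-irrefl refl (begin-strict
    pair m n                    <⟨ proj₂ (diagonal-spec (pair m n)) ⟩
    triangular (suc d)          ≤⟨ triangular-mono d<s ⟩
    triangular (m + n)          ≤⟨ m≤m+n _ n ⟩
    pair m n                    ∎))
  where
  open ≤-Reasoning
  d = diagonal (pair m n)
  pair<triangular : pair m n < triangular (suc (m + n))
  pair<triangular = s≤s (≤-trans (≤-reflexive (+-comm _ n)) (+-monoˡ-≤ _ (m≤n+m n m)))

π₂-pair : ∀ m n → π₂ (pair m n) ≡ n
π₂-pair m n rewrite diagonal-pair m n = m+n∸m≡n (triangular (m + n)) n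

π₁-pair : ∀ m n → π₁ (pair m n) ≡ m
π₁-pair m n rewrite π₂-pair m n | diagonal-pair m n = m+n∸n≡m m n

-- Computable access to encoded instances

record Encoded (ι : I → ℕ → ℕ) {Γ : List Sort} (x : I → Tuple Γ) : Set where
  constructor ⟪_⟫
  field
    unwrap : Fun₁ ι (λ i → encode (x i))

module _ {ι : I → ℕ → ℕ} where

  infixr 5 _⊕ʳ_
  _⊕ʳ_ : {f g : I → ℕ → ℕ} → Fun₁ ι f → Fun₁ ι g → Fun₁ ι (λ i → f i ⊕ g i)
  _⊕ʳ_ {f} {g} f′ g′ = fun₁ (Rec-cong (λ i v → ⊕-cases (f i) (g i) (lookup v 0F))
    ((sucʳ zeroʳ ∸ʳ parityʳ) *ʳ f′ $ʳ half +ʳ parityʳ *ʳ g′ $ʳ half))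
    where
    half = ⌊_/2⌋ʳ {ι = ι} (arg 0F)
    parityʳ = arg 0F ∸ʳ (half +ʳ half)

  leftʳ : {f g : I → ℕ → ℕ} → Fun₁ ι (λ i → f i ⊕ g i) → Fun₁ ι f
  leftʳ {f} {g} h = fun₁ (Rec-cong (λ i v → ⊕-even (f i) (g i) (lookup v 0F)) (h $ʳ (arg 0F +ʳ arg 0F)))

  rightʳ : {f g : I → ℕ → ℕ} → Fun₁ ι (λ i → f i ⊕ g i) → Fun₁ ι g
  rightʳ {f} {g} h = fun₁ (Rec-cong (λ i v → ⊕-odd (f i) (g i) (lookup v 0F)) (h $ʳ sucʳ (arg 0F +ʳ arg 0F)))

  tailʳ : {f : I → ℕ → ℕ} → Fun₁ ι f → Fun₁ ι (λ i → tail (f i))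
  tailʳ f = fun₁ (f $ʳ sucʳ arg 0F)

  consʳ : {F G : I → Vec ℕ k → ℕ} {H : I → Vec ℕ (suc k) → ℕ} →
          Rec ι F → Rec ι H → Rec ι G → Rec ι (λ i v → cons (F i v) (λ n → H i (n ∷ v)) (G i v))
  consʳ {F = F} {G} {H} F′ H′ G′ = Rec-cong eq (
    -- The two factors test the index for zero and for nonzero. At index 0 the other branch is
    -- evaluated at `pred 0` and multiplied by 0.
    (sucʳ zeroʳ ∸ʳ G′) *ʳ F′ +ʳ (sucʳ zeroʳ ∸ʳ (sucʳ zeroʳ ∸ʳ G′)) *ʳ H⟨pred⟩)
    where
    H⟨pred⟩ = compʳ {Gs = λ i v → pred (G i v) ∷ v} H′ λ { zero → predʳ G′ ; (suc j) → arg j }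
    eq : ∀ i v → (1 ∸ G i v) * F i v + (1 ∸ (1 ∸ G i v)) * H i (pred (G i v) ∷ v) ≡
                 cons (F i v) (λ n → H i (n ∷ v)) (G i v)
    eq i v with G i v
    ... | zero  = trans (+-identityʳ _) (+-identityʳ _)
    ... | suc n rewrite 0∸n≡0 n = +-identityʳ _

  triangularʳ : {F : I → Vec ℕ k → ℕ} → Rec ι F → Rec ι (λ i v → triangular (F i v))
  triangularʳ {F = F} F′ = Rec-cong (λ i v → eq (F i v)) (recʳ F′ zeroʳ (sucʳ arg 0F +ʳ arg 1F))
    where
    eq : ∀ n → primRec 0 (λ y n → suc n + y) n ≡ triangular n
    eq zero    = refl
    eq (suc n) = cong (suc n +_) (eq n)

  pairʳ : {F G : I → Vec ℕ k → ℕ} → Rec ι F → Rec ι G → Rec ι (λ i v → pair (F i v) (G i v))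
  pairʳ F G = triangularʳ (F +ʳ G) +ʳ G

  diagonalʳ : {F : I → Vec ℕ k → ℕ} → Rec ι F → Rec ι (λ i v → diagonal (F i v))
  diagonalʳ F = recʳ F zeroʳ
    (arg 1F +ʳ (sucʳ zeroʳ ∸ʳ (triangularʳ (sucʳ arg 1F) ∸ʳ sucʳ arg 0F)))

  π₂ʳ : {F : I → Vec ℕ k → ℕ} → Rec ι F → Rec ι (λ i v → π₂ (F i v))
  π₂ʳ F = F ∸ʳ triangularʳ (diagonalʳ F)

  π₁ʳ : {F : I → Vec ℕ k → ℕ} → Rec ι F → Rec ι (λ i v → π₁ (F i v))
  π₁ʳ F = diagonalʳ F ∸ʳ π₂ʳ F

  dropʳ : ∀ {s Γ} {x : I → Tuple (s ∷ Γ)} → Encoded ι x → Encoded ι (λ i → All.tail (x i))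
  dropʳ {num} {x = x} ⟪ enc ⟫ = ⟪ Fun₁-cong (λ i n → eq (x i) n) (tailʳ enc) ⟫
    where
    eq : ∀ {Γ} (x : Tuple (num ∷ Γ)) → encode x ∘ suc ≗ encode (All.tail x)
    eq (_ ∷ _) _ = refl
  dropʳ {fun} {x = x} ⟪ enc ⟫ = ⟪ rightʳ {f = λ i → All.head (x i)} (Fun₁-cong (λ i n → eq (x i) n) enc) ⟫
    where
    eq : ∀ {Γ} (x : Tuple (fun ∷ Γ)) → encode x ≗ All.head x ⊕ encode (All.tail x)
    eq (_ ∷ _) _ = refl
  dropʳ {bin} {x = x} ⟪ enc ⟫ = ⟪ rightʳ {f = λ i → toℕ ∘ All.head (x i)} (Fun₁-cong (λ i n → eq (x i) n) enc) ⟫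
    where
    eq : ∀ {Γ} (x : Tuple (bin ∷ Γ)) → encode x ≗ (toℕ ∘ All.head x) ⊕ encode (All.tail x)
    eq (_ ∷ _) _ = refl

  numʳ : ∀ {Γ} {x : I → Tuple Γ} (p : num ∈ Γ) → Encoded ι x →
         Rec {k = k} ι (λ i _ → All.lookup (x i) p)
  numʳ {x = x} (here refl) ⟪ enc ⟫ = Rec-cong (λ i _ → eq (x i)) (enc $ʳ zeroʳ)
    where
    eq : ∀ {Γ} (x : Tuple (num ∷ Γ)) → encode x 0 ≡ All.lookup x (here refl)
    eq (_ ∷ _) = refl
  numʳ {x = x} (there p) enc = Rec-cong (λ i _ → eq p (x i)) (numʳ p (dropʳ enc))
    where
    eq : ∀ {Γ s} (p : num ∈ Γ) (x : Tuple (s ∷ Γ)) → All.lookup (All.tail x) p ≡ All.lookup x (there p)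
    eq p (_ ∷ _) = refl

  funʳ : ∀ {Γ} {x : I → Tuple Γ} (p : fun ∈ Γ) → Encoded ι x → Fun₁ ι (λ i → All.lookup (x i) p)
  funʳ {x = x} (here refl) ⟪ enc ⟫ = leftʳ {g = λ i → encode (All.tail (x i))} (Fun₁-cong (λ i n → eq (x i) n) enc)
    where
    eq : ∀ {Γ} (x : Tuple (fun ∷ Γ)) → encode x ≗ All.lookup x (here refl) ⊕ encode (All.tail x)
    eq (_ ∷ _) _ = refl
  funʳ {x = x} (there p) enc = Fun₁-cong (λ i n → eq p (x i) n) (funʳ p (dropʳ enc))
    where
    eq : ∀ {Γ s} (p : fun ∈ Γ) (x : Tuple (s ∷ Γ)) → All.lookup (All.tail x) p ≗ All.lookup x (there p)
    eq p (_ ∷ _) _ = refl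

  binʳ : ∀ {Γ} {x : I → Tuple Γ} (p : bin ∈ Γ) → Encoded ι x →
         Fun₁ ι (λ i n → toℕ (All.lookup (x i) p n))
  binʳ {x = x} (here refl) ⟪ enc ⟫ = leftʳ {g = λ i → encode (All.tail (x i))} (Fun₁-cong (λ i n → eq (x i) n) enc)
    where
    eq : ∀ {Γ} (x : Tuple (bin ∷ Γ)) →
         encode x ≗ (toℕ ∘ All.lookup x (here refl)) ⊕ encode (All.tail x)
    eq (_ ∷ _) _ = refl
  binʳ {x = x} (there p) enc = Fun₁-cong (λ i n → eq p (x i) n) (binʳ p (dropʳ enc))
    where
    eq : ∀ {Γ s} (p : bin ∈ Γ) (x : Tuple (s ∷ Γ)) →
         toℕ ∘ All.lookup (All.tail x) p ≗ toℕ ∘ All.lookup x (there p)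
    eq p (_ ∷ _) _ = refl

-- Bounded formulas are uniformly decidable

-- Binders extend the context by number variables only. Their values are computed from program
-- arguments, whereas those of `Γ` are read from the oracle, so the two kinds are kept apart.
nums : ℕ → List Sort → List Sort
nums zero    Γ = Γ
nums (suc k) Γ = num ∷ nums k Γ

infixr 5 _++ᵗ_
_++ᵗ_ : ∀ {Γ} → (Fin k → ℕ) → Tuple Γ → Tuple (nums k Γ)
_++ᵗ_ {k = zero}  ρ x = x
_++ᵗ_ {k = suc k} ρ x = ρ 0F ∷ (ρ ∘ suc) ++ᵗ x

-- Zero codes truth and every positive value falsehood: conjunctions become sums and disjunctions
-- become products.
falsity : ∀ {Γ} → BoundedFormula Γ → Tuple Γ → ℕ
falsity (t ≈ᵇ u)   x = (⟦ t ⟧ᵗ x ∸ ⟦ u ⟧ᵗ x) + (⟦ u ⟧ᵗ x ∸ ⟦ t ⟧ᵗ x)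
falsity (t ≺ᵇ u)   x = suc (⟦ t ⟧ᵗ x) ∸ ⟦ u ⟧ᵗ x
falsity (¬ᵇ A)     x = 1 ∸ falsity A x
falsity (A ∧ᵇ B)   x = falsity A x + falsity B x
falsity (A ∨ᵇ B)   x = falsity A x * falsity B x
falsity (∀< t ∙ A) x = sum< (λ n → falsity A (n ∷ x)) (⟦ t ⟧ᵗ x)
falsity (∃< t ∙ A) x = product< (λ n → falsity A (n ∷ x)) (⟦ t ⟧ᵗ x)

m∸n+n∸m≡0⇒m≡n : ∀ m n → (m ∸ n) + (n ∸ m) ≡ 0 → m ≡ n
m∸n+n∸m≡0⇒m≡n m n eq =
  ≤-antisym (m∸n≡0⇒m≤n (m+n≡0⇒m≡0 _ eq)) (m∸n≡0⇒m≤n (m+n≡0⇒n≡0 (m ∸ n) eq))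

sum<≡0 : ∀ f t → (∀ n → n < t → f n ≡ 0) ⇔ sum< f t ≡ 0
sum<≡0 f t = mk⇔ (to t) (from t)
  where
  to : ∀ t → (∀ n → n < t → f n ≡ 0) → sum< f t ≡ 0
  to zero    _  = refl
  to (suc t) f0 = cong₂ _+_ (to t λ n n<t → f0 n (m<n⇒m<1+n n<t)) (f0 t ≤-refl)
  from : ∀ t → sum< f t ≡ 0 → ∀ n → n < t → f n ≡ 0
  from (suc t) eq n n<1+t with m≤n⇒m<n∨m≡n (s≤s⁻¹ n<1+t)
  ... | inj₁ n<t  = from t (m+n≡0⇒m≡0 _ eq) n n<t
  ... | inj₂ refl = m+n≡0⇒n≡0 (sum< f t) eq

product<≡0 : ∀ f t → (∃[ n ] n < t × f n ≡ 0) ⇔ product< f t ≡ 0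
product<≡0 f t = mk⇔ (λ (n , n<t , fn≡0) → to t n n<t fn≡0) (from t)
  where
  to : ∀ t n → n < t → f n ≡ 0 → product< f t ≡ 0
  to (suc t) n n<1+t fn≡0 with m≤n⇒m<n∨m≡n (s≤s⁻¹ n<1+t)
  ... | inj₁ n<t  = cong (_* f t) (to t n n<t fn≡0)
  ... | inj₂ refl = trans (cong (product< f t *_) fn≡0) (*-zeroʳ (product< f t))
  from : ∀ t → product< f t ≡ 0 → ∃[ n ] n < t × f n ≡ 0
  from (suc t) eq with m*n≡0⇒m≡0∨n≡0 (product< f t) eq
  ... | inj₁ p≡0  = let n , n<t , fn≡0 = from t p≡0 in n , m<n⇒m<1+n n<t , fn≡0
  ... | inj₂ ft≡0 = t , ≤-refl , ft≡0

falsity-correct : ∀ {Γ} (A : BoundedFormula Γ) x → ⟦ A ⟧ᵇ x ⇔ falsity A x ≡ 0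
falsity-correct (t ≈ᵇ u) x = mk⇔
  (λ eq → cong₂ _+_ (m≤n⇒m∸n≡0 (≤-reflexive eq)) (m≤n⇒m∸n≡0 (≤-reflexive (sym eq))))
  (m∸n+n∸m≡0⇒m≡n _ _)
falsity-correct (t ≺ᵇ u) x = mk⇔ m≤n⇒m∸n≡0 m∸n≡0⇒m≤n
falsity-correct (¬ᵇ A) x = mk⇔
  (λ ¬A → m≤n⇒m∸n≡0 (n≢0⇒n>0 (¬A ∘ from)))
  (λ eq a → <⇒≢ (m∸n≡0⇒m≤n eq) (sym (to a)))
  where open Equivalence (falsity-correct A x)
falsity-correct (A ∧ᵇ B) x = mk⇔
  (λ (a , b) → cong₂ _+_ (A.to a) (B.to b))
  (λ eq → A.from (m+n≡0⇒m≡0 _ eq) , B.from (m+n≡0⇒n≡0 (falsity A x) eq))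
  where
  module A = Equivalence (falsity-correct A x)
  module B = Equivalence (falsity-correct B x)
falsity-correct (A ∨ᵇ B) x = mk⇔
  (λ { (inj₁ a) → cong (_* falsity B x) (A.to a)
     ; (inj₂ b) → trans (cong (falsity A x *_) (B.to b)) (*-zeroʳ (falsity A x)) })
  (λ eq → Sum.map A.from B.from (m*n≡0⇒m≡0∨n≡0 (falsity A x) eq))
  where
  module A = Equivalence (falsity-correct A x)
  module B = Equivalence (falsity-correct B x)
falsity-correct (∀< t ∙ A) x = mk⇔
  (λ a → Equivalence.to (sum<≡0 _ _) λ n n<t → Equivalence.to (falsity-correct A (n ∷ x)) (a n n<t))
  (λ eq n n<t → Equivalence.from (falsity-correct A (n ∷ x)) (Equivalence.from (sum<≡0 _ _) eq n n<t))
falsity-correct (∃< t ∙ A) x = mk⇔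
  (λ (n , n<t , a) → Equivalence.to (product<≡0 _ _) (n , n<t , Equivalence.to (falsity-correct A (n ∷ x)) a))
  (λ eq → let n , n<t , fn≡0 = Equivalence.from (product<≡0 _ _) eq in
          n , n<t , Equivalence.from (falsity-correct A (n ∷ x)) fn≡0)

module _ {ι : I → ℕ → ℕ} {Γ} {x : I → Tuple Γ} (enc : Encoded ι x) where

  private
    Env : ℕ → ℕ → Set
    Env k l = I → Vec ℕ l → Fin k → ℕ

    Envʳ : Env k l → Set
    Envʳ w = ∀ j → Rec ι (λ i v → w i v j)

    infixr 5 _∷ʳ_
    _∷ʳ_ : {G : I → Vec ℕ l → ℕ} {w : Env k l} → Rec ι G → Envʳ w → Envʳ (λ i v → G i v Fun.∷ w i v)
    (G ∷ʳ w) zero    = G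
    (G ∷ʳ w) (suc j) = w j

    weakenᵉ : {w : Env k l} → Envʳ w → Envʳ (λ i v → w i (Vec.tail v))
    weakenᵉ w j = weaken (w j)

    numVarʳ : {w : Env k l} → Envʳ w → (p : num ∈ nums k Γ) →
              Rec ι (λ i v → All.lookup (w i v ++ᵗ x i) p)
    numVarʳ {k = zero}  w p           = numʳ p enc
    numVarʳ {k = suc k} w (here refl) = w 0F
    numVarʳ {k = suc k} w (there p)   = numVarʳ (w ∘ suc) p

    funVarʳ : {w : Env k l} {G : I → Vec ℕ l → ℕ} → Rec ι G → (p : fun ∈ nums k Γ) →
              Rec ι (λ i v → All.lookup (w i v ++ᵗ x i) p (G i v))
    funVarʳ {k = zero}  G p         = funʳ p enc $ʳ G
    funVarʳ {k = suc k} G (there p) = funVarʳ G p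

    binVarʳ : {w : Env k l} {G : I → Vec ℕ l → ℕ} → Rec ι G → (p : bin ∈ nums k Γ) →
              Rec ι (λ i v → toℕ (All.lookup (w i v ++ᵗ x i) p (G i v)))
    binVarʳ {k = zero}  G p         = binʳ p enc $ʳ G
    binVarʳ {k = suc k} G (there p) = binVarʳ G p

  termʳ : {w : Env k l} → Envʳ w → (t : Term (nums k Γ)) → Rec ι (λ i v → ⟦ t ⟧ᵗ (w i v ++ᵗ x i))
  termʳ w (var p)     = numVarʳ w p
  termʳ w (appᶠ p t)  = funVarʳ (termʳ w t) p
  termʳ w (appᵇ p t)  = binVarʳ (termʳ w t) p
  termʳ w zeroᵗ       = zeroʳ
  termʳ w (sucᵗ t)    = sucʳ termʳ w t
  termʳ w (t +ᵗ u)    = termʳ w t +ʳ termʳ w u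
  termʳ w (t *ᵗ u)    = termʳ w t *ʳ termʳ w u
  -- A `rec` term has the previous value as its newest variable, before the index; `recʳ` supplies
  -- them in the other order.
  termʳ w (rec t a b) = recʳ (termʳ w t) (termʳ w a)
    (termʳ {w = λ i v → lookup v 1F Fun.∷ lookup v 0F Fun.∷ _} (arg 1F ∷ʳ arg 0F ∷ʳ weakenᵉ (weakenᵉ w)) b)

  falsityʳ : {w : Env k l} → Envʳ w → (A : BoundedFormula (nums k Γ)) →
             Rec ι (λ i v → falsity A (w i v ++ᵗ x i))
  falsityʳ w (t ≈ᵇ u)   = (termʳ w t ∸ʳ termʳ w u) +ʳ (termʳ w u ∸ʳ termʳ w t)
  falsityʳ w (t ≺ᵇ u)   = sucʳ termʳ w t ∸ʳ termʳ w u
  falsityʳ w (¬ᵇ A)     = sucʳ zeroʳ ∸ʳ falsityʳ w A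
  falsityʳ w (A ∧ᵇ B)   = falsityʳ w A +ʳ falsityʳ w B
  falsityʳ w (A ∨ᵇ B)   = falsityʳ w A *ʳ falsityʳ w B
  falsityʳ w (∀< t ∙ A) = sumʳ (falsityʳ (arg 0F ∷ʳ weakenᵉ w) A) (termʳ w t)
  falsityʳ w (∃< t ∙ A) = productʳ (falsityʳ (arg 0F ∷ʳ weakenᵉ w) A) (termʳ w t)

-- Maxima, powers of two and halves

max<-upper : ∀ f {t n} → n < t → f n ≤ max< f t
max<-upper f {suc t} n<1+t with m≤n⇒m<n∨m≡n (s≤s⁻¹ n<1+t)
... | inj₁ n<t  = m≤n⇒m≤n⊔o _ (max<-upper f n<t)
... | inj₂ refl = m≤n⊔m _ _

⊔-elim : (P : ℕ → Set) → ∀ {m n} → P m → P n → P (m ⊔ n)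
⊔-elim P {m} {n} pm pn with ⊔-sel m n
... | inj₁ eq = subst P (sym eq) pm
... | inj₂ eq = subst P (sym eq) pn

-- A maximum is one of its entries or the starting value 0, so no closure property of `P` is
-- required.
max<-elim : ∀ f (P : ℕ → Set) → P 0 → ∀ t → (∀ n → n < t → P (f n)) → P (max< f t)
max<-elim f P p0 zero    _  = p0
max<-elim f P p0 (suc t) pf =
  ⊔-elim P (max<-elim f P p0 t λ n n<t → pf n (m<n⇒m<1+n n<t)) (pf t ≤-refl)

n<2^n : ∀ n → n < 2 ^ n
n<2^n zero    = ≤-refl
n<2^n (suc n) = +-mono-≤ (m^n>0 2 n) (≤-trans (n<2^n n) (m≤m+n _ 0))

n≤2⌈n/2⌉ : ∀ n → n ≤ 2 * ⌈ n /2⌉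
n≤2⌈n/2⌉ n = begin
  n                        ≡⟨ ⌊n/2⌋+⌈n/2⌉≡n n ⟨
  ⌊ n /2⌋ + ⌈ n /2⌉        ≤⟨ +-mono-≤ (⌊n/2⌋≤⌈n/2⌉ n) (m≤m+n _ 0) ⟩
  2 * ⌈ n /2⌉              ∎
  where open ≤-Reasoning

2⌈n/2⌉≤1+n : ∀ n → 2 * ⌈ n /2⌉ ≤ suc n
2⌈n/2⌉≤1+n zero          = z≤n
2⌈n/2⌉≤1+n (suc zero)    = ≤-refl
2⌈n/2⌉≤1+n (suc (suc n)) = begin
  2 * suc ⌈ n /2⌉      ≡⟨ *-suc 2 ⌈ n /2⌉ ⟩
  2 + 2 * ⌈ n /2⌉      ≤⟨ +-monoʳ-≤ 2 (2⌈n/2⌉≤1+n n) ⟩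
  suc (suc (suc n))    ∎
  where open ≤-Reasoning

-- The bit sequence that tracks failures

-- | c / t - 1/2 | ≤ 1 / (k + 1), without division and subtraction.
Balanced : ℕ → ℕ → ℕ → Set
Balanced k t c = suc k * (2 * c) ≤ 2 * t + suc k * t × suc k * t ≤ 2 * t + suc k * (2 * c)

-- P n a is nonzero when the requirement a fails at n.  A failure answers with
-- an excess of 2 ^ (n ∸ a) ones over zeros at length about 2 ^ (1 + n), that is,
-- with a deviation of order 2 ^ (- a), which is gone again at length 2 ^ (2 + n).
module Tracking (P : ℕ → ℕ → ℕ) where

  -- The double monus is the signum. As `2 ^ (n ∸ a)` does not increase with `a`, the least failing
  -- `a ≤ n` determines the maximum; without failures it is 0.
  excess : ℕ → ℕ
  excess n = max< (λ a → (1 ∸ (1 ∸ P n a)) * 2 ^ (n ∸ a)) (suc n)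

  -- Zero up to length `2 ^ n`, then rising by one per step until `t = 2 * 2 ^ n + excess n`, where
  -- a count of `2 ^ n + excess n` ones exceeds that of the zeros by `excess n`; constant
  -- afterwards.
  bump : ℕ → ℕ → ℕ
  bump t n = (t ∸ 2 ^ n) ⊓ (2 ^ n + excess n)

  -- The intended number of ones among the first `t` bits. Bumps with `n ≥ t` are still 0, since
  -- `n < 2 ^ n`, so the range may stop at `t`.
  ones : ℕ → ℕ
  ones t = ⌈ t /2⌉ ⊔ max< (bump t) t

  signum≤1 : ∀ n → 1 ∸ (1 ∸ n) ≤ 1
  signum≤1 n = m∸n≤m 1 (1 ∸ n)

  signum-pos : ∀ {n} → n ≢ 0 → 1 ∸ (1 ∸ n) ≡ 1
  signum-pos {zero}  n≢0 = contradiction refl n≢0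
  signum-pos {suc n} _   = cong (1 ∸_) (0∸n≡0 n)

  excess≤2^n : ∀ n → excess n ≤ 2 ^ n
  excess≤2^n n = max<-elim _ (_≤ 2 ^ n) z≤n (suc n) λ a _ →
    ≤-trans (*-mono-≤ (signum≤1 (P n a)) (^-monoʳ-≤ 2 (m∸n≤m n a))) (≤-reflexive (+-identityʳ _))

  -- Entries with `a ≤ k` vanish, and all others are at most `2 ^ (n ∸ k)`.
  excess-small : ∀ {n k} → k ≤ n → (∀ a → a ≤ k → P n a ≡ 0) → 2 ^ k * excess n ≤ 2 ^ n
  excess-small {n} {k} k≤n holds = begin
    2 ^ k * excess n       ≤⟨ *-monoʳ-≤ (2 ^ k) (max<-elim _ (_≤ 2 ^ (n ∸ k)) z≤n (suc n) small) ⟩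
    2 ^ k * 2 ^ (n ∸ k)    ≡⟨ ^-distribˡ-+-* 2 k (n ∸ k) ⟨
    2 ^ (k + (n ∸ k))      ≡⟨ cong (2 ^_) (m+[n∸m]≡n k≤n) ⟩
    2 ^ n                  ∎
    where
    open ≤-Reasoning
    small : ∀ a → a < suc n → (1 ∸ (1 ∸ P n a)) * 2 ^ (n ∸ a) ≤ 2 ^ (n ∸ k)
    small a _ with ≤-total a k
    ... | inj₁ a≤k rewrite holds a a≤k = z≤n
    ... | inj₂ k≤a = ≤-trans (*-mono-≤ (signum≤1 (P n a)) (^-monoʳ-≤ 2 (∸-monoʳ-≤ n k≤a)))
                             (≤-reflexive (+-identityʳ _))

  excess-large : ∀ {n a} → a ≤ n → P n a ≢ 0 → 2 ^ (n ∸ a) ≤ excess n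
  excess-large {n} {a} a≤n fails = begin
    2 ^ (n ∸ a)                            ≡⟨ +-identityʳ _ ⟨
    1 * 2 ^ (n ∸ a)                        ≡⟨ cong (_* 2 ^ (n ∸ a)) (signum-pos fails) ⟨
    (1 ∸ (1 ∸ P n a)) * 2 ^ (n ∸ a)        ≤⟨ max<-upper (λ a → (1 ∸ (1 ∸ P n a)) * 2 ^ (n ∸ a)) (s≤s a≤n) ⟩
    excess n                               ∎
    where open ≤-Reasoning

  ones-mono : ∀ t → ones t ≤ ones (suc t)
  ones-mono t = ⊔-mono-≤ (⌈n/2⌉-mono (n≤1+n t)) (max<-elim (bump t) (_≤ _) z≤n t λ n n<t →
    ≤-trans (⊓-monoˡ-≤ (2 ^ n + excess n) (∸-monoˡ-≤ (2 ^ n) (n≤1+n t)))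
            (max<-upper (bump (suc t)) (m<n⇒m<1+n n<t)))

  -- Every function under the maximum grows by at most one per step, and the bump that newly enters
  -- is still 0. With `ones-mono` this makes `ones` the counting function of a bit sequence.
  ones-step : ∀ t → ones (suc t) ≤ suc (ones t)
  ones-step t = ⊔-lub
    (s≤s (≤-trans (⌊n/2⌋≤⌈n/2⌉ t) (m≤m⊔n _ _)))
    (max<-elim (bump (suc t)) (_≤ _) z≤n (suc t) step)
    where
    open ≤-Reasoning
    step : ∀ n → n < suc t → bump (suc t) n ≤ suc (ones t)
    step n n<1+t with m≤n⇒m<n∨m≡n (s≤s⁻¹ n<1+t)
    ... | inj₁ n<t = begin
      (suc t ∸ 2 ^ n) ⊓ (2 ^ n + excess n)              ≤⟨ ⊓-mono-≤ 1+t∸N≤ (n≤1+n _) ⟩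
      suc ((t ∸ 2 ^ n) ⊓ (2 ^ n + excess n))            ≤⟨ s≤s (max<-upper (bump t) n<t) ⟩
      suc (max< (bump t) t)                             ≤⟨ s≤s (m≤n⊔m ⌈ t /2⌉ _) ⟩
      suc (ones t)                                      ∎
      where
      1+t∸N≤ : suc t ∸ 2 ^ n ≤ suc (t ∸ 2 ^ n)
      1+t∸N≤ = m≤n+o⇒m∸n≤o (suc t) (2 ^ n) (begin
        suc t                        ≤⟨ s≤s (m≤n+m∸n t (2 ^ n)) ⟩
        suc (2 ^ n + (t ∸ 2 ^ n))    ≡⟨ +-suc (2 ^ n) _ ⟨
        2 ^ n + suc (t ∸ 2 ^ n)      ∎)
    ... | inj₂ refl = begin
      bump (suc n) n       ≤⟨ m⊓n≤m _ _ ⟩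
      suc n ∸ 2 ^ n        ≡⟨ m≤n⇒m∸n≡0 (n<2^n n) ⟩
      0                    ≤⟨ z≤n ⟩
      suc (ones t)         ∎

  -- The lower bound is immediate from `⌈ t /2⌉ ≤ ones t`. The upper bound is checked for each
  -- function under the maximum: rounding costs at most `suc k ≤ t`, bumps with `n < M` are capped
  -- below `t / 2`, and later bumps have an excess of at most `2 ^ n / 2 ^ k`.
  ones-balanced : ∀ {k M} → k ≤ M → (∀ n a → M ≤ n → a ≤ k → P n a ≡ 0) →
                  ∀ t → 2 * 2 ^ M ≤ t → Balanced k t (ones t)
  ones-balanced {k} {M} k≤M holds t 2^1+M≤t =
    ⊔-elim Upper {⌈ t /2⌉} {max< (bump t) t} half (max<-elim (bump t) Upper upper0 t bumps) , lower
    where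
    open ≤-Reasoning
    Upper : ℕ → Set
    Upper c = suc k * (2 * c) ≤ 2 * t + suc k * t
    1+k≤2^k : suc k ≤ 2 ^ k
    1+k≤2^k = n<2^n k
    upper0 : Upper 0
    upper0 rewrite *-zeroʳ k = z≤n
    half : Upper ⌈ t /2⌉
    half = begin
      suc k * (2 * ⌈ t /2⌉)    ≤⟨ *-monoʳ-≤ (suc k) (2⌈n/2⌉≤1+n t) ⟩
      suc k * suc t            ≡⟨ *-suc (suc k) t ⟩
      suc k + suc k * t        ≤⟨ +-monoˡ-≤ (suc k * t) 1+k≤2t ⟩
      2 * t + suc k * t        ∎
      where
      1+k≤2t : suc k ≤ 2 * t
      1+k≤2t = begin
        suc k        ≤⟨ 1+k≤2^k ⟩
        2 ^ k        ≤⟨ ^-monoʳ-≤ 2 k≤M ⟩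
        2 ^ M        ≤⟨ m≤n*m (2 ^ M) 2 ⟩
        2 * 2 ^ M    ≤⟨ 2^1+M≤t ⟩
        t            ≤⟨ m≤n*m t 2 ⟩
        2 * t        ∎
    bumps : ∀ n → n < t → Upper (bump t n)
    bumps n _ with <-≤-connex n M
    ... | inj₁ n<M = begin
      suc k * (2 * bump t n)    ≤⟨ *-monoʳ-≤ (suc k) 2bump≤t ⟩
      suc k * t                 ≤⟨ m≤n+m _ (2 * t) ⟩
      2 * t + suc k * t         ∎
      where
      2bump≤t : 2 * bump t n ≤ t
      2bump≤t = begin
        2 * bump t n                ≤⟨ *-monoʳ-≤ 2 (m⊓n≤n (t ∸ 2 ^ n) _) ⟩
        2 * (2 ^ n + excess n)      ≤⟨ *-monoʳ-≤ 2 (+-monoʳ-≤ (2 ^ n) (≤-trans (excess≤2^n n) (m≤m+n _ 0))) ⟩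
        2 * 2 ^ suc n               ≤⟨ *-monoʳ-≤ 2 (^-monoʳ-≤ 2 n<M) ⟩
        2 * 2 ^ M                   ≤⟨ 2^1+M≤t ⟩
        t                           ∎
    ... | inj₂ M≤n with ≤-total (2 ^ n) t
    ...   | inj₂ t≤2^n rewrite m≤n⇒m∸n≡0 t≤2^n = upper0
    ...   | inj₁ 2^n≤t = begin
      suc k * (2 * bump t n)              ≤⟨ *-monoʳ-≤ (suc k) 2bump≤ ⟩
      suc k * (excess n + t)              ≡⟨ *-distribˡ-+ (suc k) (excess n) t ⟩
      suc k * excess n + suc k * t        ≤⟨ +-monoˡ-≤ (suc k * t) [1+k]excess≤2t ⟩
      2 * t + suc k * t                   ∎
      where
      2bump≤ : 2 * bump t n ≤ excess n + t
      -- One copy of the bump is bounded by its cap, the other by its rising part; together the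
      -- powers `2 ^ n` make up `t`.
      2bump≤ = begin
        bump t n + (bump t n + 0)                ≤⟨ +-mono-≤ (m⊓n≤n (t ∸ 2 ^ n) _)
                                                      (≤-trans (≤-reflexive (+-identityʳ _)) (m⊓n≤m (t ∸ 2 ^ n) _)) ⟩
        (2 ^ n + excess n) + (t ∸ 2 ^ n)         ≡⟨ cong (_+ (t ∸ 2 ^ n)) (+-comm (2 ^ n) (excess n)) ⟩
        (excess n + 2 ^ n) + (t ∸ 2 ^ n)         ≡⟨ +-assoc (excess n) (2 ^ n) _ ⟩
        excess n + (2 ^ n + (t ∸ 2 ^ n))         ≡⟨ cong (excess n +_) (m+[n∸m]≡n 2^n≤t) ⟩
        excess n + t                             ∎
      [1+k]excess≤2t : suc k * excess n ≤ 2 * t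
      [1+k]excess≤2t = begin
        suc k * excess n    ≤⟨ *-monoˡ-≤ (excess n) 1+k≤2^k ⟩
        2 ^ k * excess n    ≤⟨ excess-small (≤-trans k≤M M≤n) (λ a → holds n a M≤n) ⟩
        2 ^ n               ≤⟨ 2^n≤t ⟩
        t                   ≤⟨ m≤n*m t 2 ⟩
        2 * t               ∎
    lower : suc k * t ≤ 2 * t + suc k * (2 * ones t)
    lower = begin
      suc k * t                           ≤⟨ *-monoʳ-≤ (suc k) (≤-trans (n≤2⌈n/2⌉ t) (*-monoʳ-≤ 2 (m≤m⊔n ⌈ t /2⌉ (max< (bump t) t)))) ⟩
      suc k * (2 * ones t)                ≤⟨ m≤n+m _ (2 * t) ⟩
      2 * t + suc k * (2 * ones t)        ∎

  -- With `e = 2 ^ (n ∸ a)` there are at least `2 ^ n + e` ones, hence at least `e` more ones than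
  -- zeros. Balance would give `K * e ≤ 2 * t`, but `K = 4 * 2 ^ a + 3` makes `K * e` equal to
  -- `4 * 2 ^ n + 3 * e`, which is `2 * t + e`.
  ones-unbalanced : ∀ {n a} → a ≤ n → P n a ≢ 0 →
                    let t = 2 * 2 ^ n + 2 ^ (n ∸ a) in ¬ Balanced (4 * 2 ^ a + 2) t (ones t)
  ones-unbalanced {n} {a} a≤n fails (upper , _) = <-irrefl refl (begin-strict
    2 * t + K * t                       ≡⟨ cong (λ N → 2 * (2 * N + e) + K * t) 2^n≡ ⟩
    2 * (2 * (2 ^ a * e) + e) + K * t   <⟨ m<m+n _ (m^n>0 2 (n ∸ a)) ⟩
    2 * (2 * (2 ^ a * e) + e) + K * t + e
                                        ≡⟨ lemma₁ (2 ^ a) e (K * t) ⟩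
    K * t + K * e                       ≡⟨ lemma₂ K (2 ^ n) e ⟩
    K * (2 * (2 ^ n + e))               ≤⟨ *-monoʳ-≤ K (*-monoʳ-≤ 2 ones-large) ⟩
    K * (2 * ones t)                    ≤⟨ upper ⟩
    2 * t + K * t                       ∎)
    where
    open ≤-Reasoning
    e = 2 ^ (n ∸ a)
    t = 2 * 2 ^ n + e
    K = suc (4 * 2 ^ a + 2)
    2^n≡ : 2 ^ n ≡ 2 ^ a * e
    2^n≡ = trans (cong (2 ^_) (sym (m+[n∸m]≡n a≤n))) (^-distribˡ-+-* 2 a (n ∸ a))
    lemma₁ : ∀ A e m → 2 * (2 * (A * e) + e) + m + e ≡ m + suc (4 * A + 2) * e
    lemma₁ = solve-∀
    lemma₂ : ∀ K N e → K * (2 * N + e) + K * e ≡ K * (2 * (N + e))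
    lemma₂ = solve-∀
    t≡ : t ≡ 2 ^ n + (2 ^ n + e)
    t≡ = trans (cong (_+ e) (cong (2 ^ n +_) (+-identityʳ (2 ^ n)))) (+-assoc (2 ^ n) (2 ^ n) e)
    ones-large : 2 ^ n + e ≤ ones t
    ones-large = begin
      -- If a smaller requirement fails too, `excess n` exceeds `e`; the bump is then still rising
      -- at `t`, and its value there is the same.
      2 ^ n + e               ≤⟨ ⊓-glb (≤-reflexive (sym (trans (cong (_∸ 2 ^ n) t≡) (m+n∸m≡n (2 ^ n) (2 ^ n + e)))))
                                       (+-monoʳ-≤ (2 ^ n) (excess-large a≤n fails)) ⟩
      bump t n                ≤⟨ max<-upper (bump t) (≤-trans (n<2^n n) (≤-trans (m≤m+n _ _) (≤-reflexive (sym t≡)))) ⟩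
      max< (bump t) t         ≤⟨ m≤n⊔m ⌈ t /2⌉ _ ⟩
      ones t                  ∎

  bit : ℕ → Fin 2
  bit zero    = 0F
  bit (suc _) = 1F

  toℕ-bit : ∀ {n} → n ≤ 1 → toℕ (bit n) ≡ n
  toℕ-bit z≤n       = refl
  toℕ-bit (s≤s z≤n) = refl

  bits : ℕ → Fin 2
  bits t = bit (ones (suc t) ∸ ones t)

  toℕ-bits : ∀ t → toℕ (bits t) ≡ ones (suc t) ∸ ones t
  toℕ-bits t = toℕ-bit (≤-trans (∸-monoˡ-≤ (ones t) (ones-step t)) (≤-reflexive (m+n∸n≡m 1 (ones t))))

  sum<-bits : ∀ t → sum< (toℕ ∘ bits) t ≡ ones t
  sum<-bits zero    = refl
  sum<-bits (suc t) = begin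
    sum< (toℕ ∘ bits) t + toℕ (bits t)        ≡⟨ cong₂ _+_ (sum<-bits t) (toℕ-bits t) ⟩
    ones t + (ones (suc t) ∸ ones t)          ≡⟨ m+[n∸m]≡n (ones-mono t) ⟩
    ones (suc t)                              ∎
    where open ≡-Reasoning

-- Frequencies as counts and rational inequalities

sum<-suc : ∀ f t → sum< f (suc t) ≡ f 0 + sum< (f ∘ suc) t
sum<-suc f zero    = sym (+-identityʳ (f 0))
sum<-suc f (suc t) = trans (cong (_+ f (suc t)) (sum<-suc f t)) (+-assoc (f 0) _ _)

count-↾ : ∀ x t → Vec.count (Fin._≟ 1F) (x ↾ t) ≡ sum< (toℕ ∘ x) t
count-↾ x zero    = refl
count-↾ x (suc t) = trans (step (x 0)) (sym (sum<-suc (toℕ ∘ x) t))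
  where
  step : ∀ b → Vec.count (Fin._≟ 1F) (b ∷ (x ∘ suc) ↾ t) ≡ toℕ b + sum< (toℕ ∘ x ∘ suc) t
  step 0F = count-↾ (x ∘ suc) t
  step 1F = cong suc (count-↾ (x ∘ suc) t)

toℚᵘ-/ : ∀ c d → toℚᵘ (ℤ.+ c ℚ./ suc d) ℚᵘ.≃ mkℚᵘ (ℤ.+ c) d
toℚᵘ-/ c d = ℚ.toℚᵘ-fromℚᵘ (mkℚᵘ (ℤ.+ c) d)

-- Unnormalised fractions are subtracted without reduction, so the difference has an explicit
-- numerator and denominator and the inequality can be cleared of fractions.
toℚᵘ-∣p-½∣ : ∀ c d → toℚᵘ ℚ.∣ ℤ.+ c ℚ./ suc d ℚ.- ½ ∣ ℚᵘ.≃ ℚᵘ.∣ mkℚᵘ (ℤ.+ c) d ℚᵘ.- ℚᵘ.½ ∣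
toℚᵘ-∣p-½∣ c d = begin
  toℚᵘ ℚ.∣ ℤ.+ c ℚ./ suc d ℚ.- ½ ∣            ≈⟨ ℚ.toℚᵘ-homo-∣-∣ (ℤ.+ c ℚ./ suc d ℚ.- ½) ⟩
  ℚᵘ.∣ toℚᵘ (ℤ.+ c ℚ./ suc d ℚ.- ½) ∣         ≈⟨ ℚᵘ.∣-∣-cong (ℚ.toℚᵘ-homo-+ (ℤ.+ c ℚ./ suc d) (ℚ.- ½)) ⟩
  ℚᵘ.∣ toℚᵘ (ℤ.+ c ℚ./ suc d) ℚᵘ.- ℚᵘ.½ ∣     ≈⟨ ℚᵘ.∣-∣-cong (ℚᵘ.+-congˡ (ℚᵘ.- ℚᵘ.½) (toℚᵘ-/ c d)) ⟩
  ℚᵘ.∣ mkℚᵘ (ℤ.+ c) d ℚᵘ.- ℚᵘ.½ ∣             ∎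
  where open ℚᵘ.≃-Reasoning

∣p-½∣-numerator : ∀ c d → ℚᵘ.∣ mkℚᵘ (ℤ.+ c) d ℚᵘ.- ℚᵘ.½ ∣ ≡ mkℚᵘ (ℤ.+ ℤ.∣ 2 * c ⊖ suc d ∣) (suc (d * 2))
∣p-½∣-numerator c d = cong (λ n → mkℚᵘ (ℤ.+ ℤ.∣ n ∣) _) (begin
  ℤ.+ c ℤ.* ℤ.+ 2 ℤ.+ ℤ.-1ℤ ℤ.* ℤ.+ suc d    ≡⟨ cong₂ ℤ._+_ (sym (ℤ.pos-* c 2)) (ℤ.-1*i≡-i (ℤ.+ suc d)) ⟩
  ℤ.+ (c * 2) ℤ.- ℤ.+ suc d                ≡⟨ ℤ.m-n≡m⊖n (c * 2) (suc d) ⟩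
  c * 2 ⊖ suc d                        ≡⟨ cong (_⊖ suc d) (*-comm c 2) ⟩
  2 * c ⊖ suc d                        ∎)
  where open ≡-Reasoning

[m∸n]*k≤b⇔ : ∀ m n k b → (m ∸ n) * k ≤ b ⇔ k * m ≤ b + k * n
[m∸n]*k≤b⇔ m n k b = mk⇔
  (λ le → begin
    k * m                      ≤⟨ m≤n+m∸n (k * m) (k * n) ⟩
    k * n + (k * m ∸ k * n)    ≤⟨ +-monoʳ-≤ (k * n) (subst (_≤ b) eq le) ⟩
    k * n + b                  ≡⟨ +-comm (k * n) b ⟩
    b + k * n                  ∎)
  (λ le → subst (_≤ b) (sym eq)
    (m≤n+o⇒m∸n≤o (k * m) (k * n) (≤-trans le (≤-reflexive (+-comm b (k * n))))))
  where
  open ≤-Reasoning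
  eq : (m ∸ n) * k ≡ k * m ∸ k * n
  eq = trans (*-comm (m ∸ n) k) (*-distribˡ-∸ k m n)

-- One of the two bounds follows from the order of `m` and `n` alone; the other is the estimate for
-- truncated subtraction.
∣m⊖n∣*k≤b⇔ : ∀ m n k b → ℤ.∣ m ⊖ n ∣ * k ≤ b ⇔ (k * m ≤ b + k * n × k * n ≤ b + k * m)
∣m⊖n∣*k≤b⇔ m n k b with ≤-total m n
... | inj₁ m≤n rewrite ℤ.∣⊖∣-≤ m≤n = mk⇔
  (λ le → m≤n⇒m≤o+n b (*-monoʳ-≤ k m≤n) , Equivalence.to ([m∸n]*k≤b⇔ n m k b) le)
  (λ (_ , le) → Equivalence.from ([m∸n]*k≤b⇔ n m k b) le)
... | inj₂ n≤m rewrite ℤ.∣m⊖n∣≡∣n⊖m∣ m n | ℤ.∣⊖∣-≤ n≤m = mk⇔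
  (λ le → Equivalence.to ([m∸n]*k≤b⇔ m n k b) le , m≤n⇒m≤o+n b (*-monoʳ-≤ k n≤m))
  (λ (le , _) → Equivalence.from ([m∸n]*k≤b⇔ m n k b) le)

∣c/t-½∣≤⇔Balanced : ∀ c d k → ℚ.∣ ℤ.+ c ℚ./ suc d ℚ.- ½ ∣ ℚ.≤ ℤ.+ 1 ℚ./ suc k ⇔ Balanced k (suc d) c
∣c/t-½∣≤⇔Balanced c d k = mk⇔ (to ∘ ≤→) (≤← ∘ from)
  where
  open Equivalence (∣m⊖n∣*k≤b⇔ (2 * c) (suc d) (suc k) (2 * suc d))
  n = ℤ.∣ 2 * c ⊖ suc d ∣
  lhs≃ : toℚᵘ ℚ.∣ ℤ.+ c ℚ./ suc d ℚ.- ½ ∣ ℚᵘ.≃ mkℚᵘ (ℤ.+ n) (suc (d * 2))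
  lhs≃ = ℚᵘ.≃-trans (toℚᵘ-∣p-½∣ c d) (ℚᵘ.≃-reflexive (∣p-½∣-numerator c d))
  rhs≡ : ℤ.+ 1 ℤ.* ℤ.+ (suc d * 2) ≡ ℤ.+ (2 * suc d)
  rhs≡ = trans (ℤ.*-identityˡ _) (cong ℤ.+_ (*-comm (suc d) 2))
  ≤→ : ℚ.∣ ℤ.+ c ℚ./ suc d ℚ.- ½ ∣ ℚ.≤ ℤ.+ 1 ℚ./ suc k → n * suc k ≤ 2 * suc d
  ≤→ le = ℤ.drop‿+≤+ (subst₂ ℤ._≤_ (sym (ℤ.pos-* n (suc k))) rhs≡ (ℚᵘ.drop-*≤*
    (ℚᵘ.≤-respˡ-≃ lhs≃ (ℚᵘ.≤-respʳ-≃ (toℚᵘ-/ 1 k) (ℚ.toℚᵘ-mono-≤ le)))))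
  ≤← : n * suc k ≤ 2 * suc d → ℚ.∣ ℤ.+ c ℚ./ suc d ℚ.- ½ ∣ ℚ.≤ ℤ.+ 1 ℚ./ suc k
  ≤← le = ℚ.toℚᵘ-cancel-≤ (ℚᵘ.≤-respˡ-≃ (ℚᵘ.≃-sym lhs≃) (ℚᵘ.≤-respʳ-≃ (ℚᵘ.≃-sym (toℚᵘ-/ 1 k))
    (*≤* (subst₂ ℤ._≤_ (ℤ.pos-* n (suc k)) (sym rhs≡) (ℤ.+≤+ le)))))

-- Simple normality as a descending bounded formula

matrixOf : ∀ {Γ} → ∀∀∞-Formula Γ → Tuple (num ∷ num ∷ Γ) → Set
matrixOf (quant _ (quant _ (matrix θ))) = θ

-- max t 1 is the denominator at t = 0, since Freq₁ [] = 0 / 1.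
SimpNormal⇔Balanced : ∀ t k x → matrixOf SimpNormal (t ∷ k ∷ x ∷ []) ⇔
                      Balanced k (primRec 1 (λ _ n → suc n) t) (sum< (toℕ ∘ x) t)
SimpNormal⇔Balanced zero    k x = ∣c/t-½∣≤⇔Balanced 0 0 k
SimpNormal⇔Balanced (suc d) k x rewrite sym (count-↾ x (suc d)) =
  ∣c/t-½∣≤⇔Balanced (Vec.count (Fin._≟ 1F) (x ↾ suc d)) d k

SimpNormal-bounded : BoundedMatrix SimpNormal
SimpNormal-bounded = A , λ { (t ∷ k ∷ x ∷ []) → mk⇔
  (λ θ → let l , u = Equivalence.to (SimpNormal⇔Balanced t k x) θ in s≤s l , s≤s u)
  (λ (l , u) → Equivalence.from (SimpNormal⇔Balanced t k x) (s≤s⁻¹ l , s≤s⁻¹ u)) }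
  where
  tᵗ kᵗ cᵗ 2ᵗ : Term (num ∷ num ∷ bin ∷ [])
  tᵗ = rec (var (here refl)) (sucᵗ zeroᵗ) (sucᵗ (var (there (here refl))))
  kᵗ = sucᵗ (var (there (here refl)))
  cᵗ = rec (var (here refl)) zeroᵗ
         (var (here refl) +ᵗ appᵇ (there (there (there (there (here refl))))) (var (there (here refl))))
  2ᵗ = sucᵗ (sucᵗ zeroᵗ)
  A : BoundedFormula (num ∷ num ∷ bin ∷ [])
  A = ((kᵗ *ᵗ (2ᵗ *ᵗ cᵗ)) ≺ᵇ sucᵗ ((2ᵗ *ᵗ tᵗ) +ᵗ (kᵗ *ᵗ tᵗ))) ∧ᵇ
      ((kᵗ *ᵗ tᵗ) ≺ᵇ sucᵗ ((2ᵗ *ᵗ tᵗ) +ᵗ (kᵗ *ᵗ (2ᵗ *ᵗ cᵗ))))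

1/[1+n]-antitone : ∀ {m n} → m ≤ n → ℤ.+ 1 ℚ./ suc n ℚ.≤ ℤ.+ 1 ℚ./ suc m
1/[1+n]-antitone {m} {n} m≤n = ℚ.toℚᵘ-cancel-≤
  (ℚᵘ.≤-respˡ-≃ (ℚᵘ.≃-sym (toℚᵘ-/ 1 n)) (ℚᵘ.≤-respʳ-≃ (ℚᵘ.≃-sym (toℚᵘ-/ 1 m))
    (*≤* (subst₂ ℤ._≤_ (sym (ℤ.*-identityˡ _)) (sym (ℤ.*-identityˡ _)) (ℤ.+≤+ (s≤s m≤n))))))

SimpNormal-Is∀↓∀∞ : Is∀↓∀∞ SimpNormal
SimpNormal-Is∀↓∀∞ = SimpNormal-bounded ,
  λ { ((_ ∷ []) , _) k k′ k′≤k (s , θ) →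
      s , λ t s≤t → ℚ.≤-trans (θ t s≤t) (1/[1+n]-antitone k′≤k) }

-- Uniform transformations of solutions

fun₁-code : {ι f : I → ℕ → ℕ} → Fun₁ ι f → ∃[ e ] (∀ i → Computes e (ι i) (f i))
fun₁-code f = Rec.code f′ , λ i n → Rec.correct f′ i (n ∷ [])
  where f′ = f $ʳ arg {k = 1} 0F

code-fun₁ : {ι f : I → ℕ → ℕ} (e : Code 1) → (∀ i → Computes e (ι i) (f i)) → Fun₁ ι f
code-fun₁ e e⇓ = fun₁ (e , λ { i (n ∷ []) → e⇓ i n })

rebase₁ : {ι : I → ℕ → ℕ} {ι′ : I′ → ℕ → ℕ} {f : I′ → ℕ → ℕ} {h : I → I′} →
          Fun₁ ι (λ i → ι′ (h i)) → Fun₁ ι′ f → Fun₁ ι (λ i → f (h i))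
rebase₁ {h = h} ι′ f = fun₁ (rebase {h = h} ι′ (f $ʳ arg 0F))

instanceOracle : ∀ {Γ} → Instance Γ → ℕ → ℕ
instanceOracle (x , _) = encode x

Solutions : List Sort → Set₁
Solutions Γ = Instance Γ → (ℕ → ℕ) → Set

-- Serves as the index set of `Rec`: programs need to be correct only on inputs that carry a
-- solution.
Solved : ∀ {Γ} → Solutions Γ → Set
Solved A = ∃[ x ] ∃[ α ] A x α

input : ∀ {Γ} {A : Solutions Γ} → Solved A → ℕ → ℕ
input (x , α , _) = α ⊕ instanceOracle x

infix 4 _⇝_
_⇝_ : ∀ {Γ} → Solutions Γ → Solutions Γ → Set
A ⇝ B = ∃[ e ] (∀ x α → A x α → ∃[ β ] Computes e (α ⊕ encode (proj₁ x)) β × B x β)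

module _ {Γ : List Sort} where

  solutionʳ : {A : Solutions Γ} → Fun₁ (input {A = A}) (λ (_ , α , _) → α)
  solutionʳ = leftʳ {g = λ (x , _ , _) → instanceOracle x} oracleʳ

  instanceʳ : {A : Solutions Γ} → Fun₁ (input {A = A}) (λ (x , _ , _) → instanceOracle x)
  instanceʳ = rightʳ {f = λ (_ , α , _) → α} oracleʳ

  transform : {A B : Solutions Γ} (f : Solved A → ℕ → ℕ) → Fun₁ (input {A = A}) f →
              (∀ s → B (proj₁ s) (f s)) → A ⇝ B
  transform f f′ f-solves = let e , e⇓ = fun₁-code f′ in
    e , λ x α a → f (x , α , a) , e⇓ (x , α , a) , f-solves (x , α , a)

  ⇝-trans : {A B C : Solutions Γ} → A ⇝ B → B ⇝ C → A ⇝ C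
  ⇝-trans {A} {B} {C} (d , B-of) (e , C-of) = transform γ
    -- The second program expects the intermediate solution paired with the instance; this pair is
    -- computed from the first input.
    (rebase₁ {h = toB} (code-fun₁ d d⇓ ⊕ʳ instanceʳ)
      (code-fun₁ {ι = input {A = B}} e λ (x , β , b) → proj₁ (proj₂ (C-of x β b))))
    (λ (x , α , a) → let β , _ , b = B-of x α a in proj₂ (proj₂ (C-of x β b)))
    where
    toB : Solved A → Solved B
    toB (x , α , a) = let β , _ , b = B-of x α a in x , β , b
    d⇓ : ∀ (s : Solved A) → Computes d (input s) (proj₁ (proj₂ (toB s)))
    d⇓ (x , α , a) = proj₁ (proj₂ (B-of x α a))
    γ : Solved A → ℕ → ℕ
    γ s = let x , β , b = toB s in proj₁ (C-of x β b)

-- Witnesses as moduli and recurrences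

rows : (ℕ → ℕ → ℕ) → ℕ → ℕ
rows F p = F (π₁ p) (π₂ p)

row-rows : ∀ F n → row (rows F) n ≗ F n
row-rows F n m = cong₂ F (π₁-pair n m) (π₂-pair n m)

∀∀∞-formula : ∀ {Γ} → (Tuple (num ∷ num ∷ Γ) → Set) → ∀∀∞-Formula Γ
∀∀∞-formula θ = quant ∀′ (quant ∀∞ (matrix θ))

module _ {Γ : List Sort} (θ : Tuple (num ∷ num ∷ Γ) → Set) (x : Tuple Γ) where

  -- The content of a witness: its innermost entries are forced to encode the instance, and entries
  -- below the bound are unconstrained, so only the bounds remain.
  Modulus : (ℕ → ℕ) → Set
  Modulus S = ∀ a n → S a ≤ n → θ (n ∷ a ∷ x)

  -- The content of a dual witness: `head α` is the requirement that keeps failing, `tail α m` a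
  -- failure at or beyond `m`.
  Recurrence : (ℕ → ℕ) → Set
  Recurrence α = ∀ m → m ≤ tail α m × ¬ θ (tail α m ∷ head α ∷ x)

  True⇔Modulus : True (∀∀∞-formula θ) x ⇔ (∃[ S ] Modulus S)
  True⇔Modulus = mk⇔ (λ h → proj₁ ∘ h , proj₂ ∘ h) (λ (S , mod) a → S a , mod a)

  True⇔Recurrence : True (dual (∀∀∞-formula θ)) x ⇔ (∃[ α ] Recurrence α)
  True⇔Recurrence = mk⇔
    (λ (a , h) → cons a (proj₁ ∘ h) , proj₂ ∘ h) (λ (α , recurs) → head α , λ m → tail α m , recurs m)

  witness⇒modulus : ∀ α → α ⊩ ∀∀∞-formula θ at x → Modulus (λ a → head (row α a))
  witness⇒modulus α w a n le = proj₂ (w a n le)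

  witness⇒recurrence : ∀ α → α ⊩ dual (∀∀∞-formula θ) at x →
                       Recurrence (cons (head α) (λ m → head (row (tail α) m)))
  witness⇒recurrence α w m = proj₁ (w m) , proj₂ (proj₂ (w m))

  modulusWitness : (ℕ → ℕ) → ℕ → ℕ
  modulusWitness S = rows λ a → cons (S a) (rows λ n → encode {num ∷ num ∷ Γ} (n ∷ a ∷ x))

  modulus⇒witness : ∀ S → Modulus S → modulusWitness S ⊩ ∀∀∞-formula θ at x
  modulus⇒witness S mod a n le =
    (λ j → trans (row-rows F a (suc (pair n j))) (row-rows (λ n → encode {num ∷ num ∷ Γ} (n ∷ a ∷ x)) n j)) ,
    mod a n (subst (_≤ n) (row-rows F a 0) le)
    where F = λ a → cons (S a) (rows λ n → encode {num ∷ num ∷ Γ} (n ∷ a ∷ x))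

  recurrenceWitness : (ℕ → ℕ) → ℕ → ℕ
  recurrenceWitness α = cons (head α) (rows λ m →
    cons (tail α m) (encode {num ∷ num ∷ Γ} (tail α m ∷ head α ∷ x)))

  recurrence⇒witness : ∀ α → Recurrence α → recurrenceWitness α ⊩ dual (∀∀∞-formula θ) at x
  recurrence⇒witness α recurs m =
    subst (λ n → m ≤ n × tail (row (rows F) m) ⊩ matrix (λ x → ¬ θ x) at n ∷ head α ∷ x)
      (sym (row-rows F m 0)) (proj₁ (recurs m) , row-rows F m ∘ suc , proj₂ (recurs m))
    where F = λ m → cons (tail α m) (encode {num ∷ num ∷ Γ} (tail α m ∷ head α ∷ x))

record Represents {Q Γ Δ} (A : Solutions Γ) (φ : Formula Q Δ) (z : Instance Γ → Tuple Δ) : Set where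
  field
    truth       : ∀ x → True φ (z x) ⇔ ∃ (A x)
    fromWitness : (λ x α → α ⊩ φ at z x) ⇝ A
    toWitness   : A ⇝ (λ x α → α ⊩ φ at z x)

module _ {Γ Δ : List Sort} (θ : Tuple (num ∷ num ∷ Δ) → Set) (z : Instance Γ → Tuple Δ) where

  witness⇝modulus : (λ x α → α ⊩ ∀∀∞-formula θ at z x) ⇝ (λ x → Modulus θ (z x))
  witness⇝modulus = transform (λ (_ , α , _) a → head (row α a))
    (fun₁ (solutionʳ $ʳ pairʳ (arg 0F) zeroʳ))
    (λ (x , α , w) → witness⇒modulus θ (z x) α w)

  witness⇝recurrence : (λ x α → α ⊩ dual (∀∀∞-formula θ) at z x) ⇝ (λ x → Recurrence θ (z x))
  witness⇝recurrence = transform (λ (_ , α , _) → cons (head α) (λ m → head (row (tail α) m)))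
    (fun₁ (consʳ (solutionʳ $ʳ zeroʳ) (solutionʳ $ʳ sucʳ pairʳ (arg 0F) zeroʳ) (arg 0F)))
    (λ (x , α , w) → witness⇒recurrence θ (z x) α w)

  module _ (z′ : Fun₁ instanceOracle (encode ∘ z)) where

    private
      zʳ : {A : Solutions Γ} → Fun₁ (input {A = A}) (encode ∘ z ∘ proj₁)
      zʳ = rebase₁ {h = proj₁} instanceʳ z′

    modulus⇝witness : (λ x → Modulus θ (z x)) ⇝ (λ x α → α ⊩ ∀∀∞-formula θ at z x)
    modulus⇝witness = transform (λ (x , S , _) → modulusWitness θ (z x) S)
      (fun₁ (consʳ (solutionʳ $ʳ π₁ʳ (arg 0F))
              (consʳ (π₁ʳ (arg 0F)) (consʳ (π₁ʳ (arg 2F)) (zʳ $ʳ arg 0F) (arg 0F)) (π₂ʳ (arg 0F)))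
              (π₂ʳ (arg 0F))))
      (λ (x , S , mod) → modulus⇒witness θ (z x) S mod)

    recurrence⇝witness : (λ x → Recurrence θ (z x)) ⇝ (λ x α → α ⊩ dual (∀∀∞-formula θ) at z x)
    recurrence⇝witness = transform (λ (x , α , _) → recurrenceWitness θ (z x) α)
      (fun₁ (consʳ (solutionʳ $ʳ zeroʳ)
              (consʳ (solutionʳ $ʳ sucʳ π₁ʳ (arg 0F))
                (consʳ (solutionʳ $ʳ sucʳ π₁ʳ (arg 1F))
                  (consʳ (solutionʳ $ʳ zeroʳ) (zʳ $ʳ arg 0F) (arg 0F))
                  (arg 0F))
                (π₂ʳ (arg 0F)))
              (arg 0F)))
      (λ (x , α , recurs) → recurrence⇒witness θ (z x) α recurs)

    modulus-represents : Represents (λ x → Modulus θ (z x)) (∀∀∞-formula θ) z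
    modulus-represents = record
      { truth       = λ x → True⇔Modulus θ (z x)
      ; fromWitness = witness⇝modulus
      ; toWitness   = modulus⇝witness
      }

    recurrence-represents : Represents (λ x → Recurrence θ (z x)) (dual (∀∀∞-formula θ)) z
    recurrence-represents = record
      { truth       = λ x → True⇔Recurrence θ (z x)
      ; fromWitness = witness⇝recurrence
      ; toWitness   = recurrence⇝witness
      }

-- Since truth is the existence of a solution, the two translations of solutions yield the
-- equivalence of truth along with both witness maps.
reduces : ∀ {Q R Γ Δ} {φ : Formula Q Γ} {ψ : Formula R Δ} {A B : Solutions Γ} (η : ComputableMap Γ Δ) →
          Represents A φ proj₁ → Represents B ψ (proj₁ ∘ ComputableMap.apply η) →
          A ⇝ B → B ⇝ A → ReducesVia η φ ψ
reduces η A-rep B-rep A⇝B@(_ , B-of) B⇝A@(_ , A-of) = record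
  { truth      = λ x → mk⇔
      (λ t → let α , a = Equivalence.to (A.truth x) t ; β , _ , b = B-of x α a in
             Equivalence.from (B.truth x) (β , b))
      (λ t → let β , b = Equivalence.to (B.truth x) t ; α , _ , a = A-of x β b in
             Equivalence.from (A.truth x) (α , a))
  ; r₋         = proj₁ r₋
  ; r₊         = proj₁ r₊
  ; r₋-witness = proj₂ r₋
  ; r₊-witness = proj₂ r₊
  }
  where
  module A = Represents A-rep
  module B = Represents B-rep
  r₋ = ⇝-trans (⇝-trans A.fromWitness A⇝B) B.toWitness
  r₊ = ⇝-trans (⇝-trans B.fromWitness B⇝A) A.toWitness

-- The reduction to simple normality

≤sum< : ∀ f {t n} → n < t → f n ≤ sum< f t
≤sum< f {suc t} n<1+t with m≤n⇒m<n∨m≡n (s≤s⁻¹ n<1+t)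
... | inj₁ n<t  = m≤n⇒m≤n+o _ (≤sum< f n<t)
... | inj₂ refl = m≤n+m _ _

least : ∀ (f : ℕ → ℕ) n → f n ≡ 0 → ∃[ m ] f m ≡ 0 × (∀ j → j < m → f j ≢ 0)
least f zero    fn≡0 = 0 , fn≡0 , λ _ ()
least f (suc n) fn≡0 with f 0 ≟ 0
... | yes f0≡0 = 0 , f0≡0 , λ _ ()
... | no  f0≢0 with least (f ∘ suc) n fn≡0
...   | m , fm≡0 , below = suc m , fm≡0 , λ { zero _ → f0≢0 ; (suc j) j<m → below j (s≤s⁻¹ j<m) }

-- The sum dominates the moduli `S 0` to `S k`; the summand `k` secures `k ≤ M` in `ones-balanced`.
balancedFrom : ℕ → (ℕ → ℕ) → ℕ
balancedFrom k S = 2 * 2 ^ (k + sum< S (suc k))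

module _ (P : ℕ → ℕ → ℕ) where
  open Tracking P

  eventually-balanced : ∀ {k S} → (∀ n a → a ≤ k → S a ≤ n → P n a ≡ 0) →
                        ∀ t → balancedFrom k S ≤ t → Balanced k t (ones t)
  eventually-balanced {k} {S} holds = ones-balanced {k} {k + sum< S (suc k)} (m≤m+n k _) λ n a M≤n a≤k →
    holds n a a≤k (≤-trans (≤sum< S (s≤s a≤k)) (≤-trans (m≤n+m _ k) M≤n))

  -- Positivity matters: at `t = 0` the matrix corresponds to denominator 1, not `t`.
  SimpNormal-bits : ∀ {t} k → 0 < t → matrixOf SimpNormal (t ∷ k ∷ bits ∷ []) ⇔ Balanced k t (ones t)
  SimpNormal-bits {t@(suc _)} k _ = subst (λ c → matrixOf SimpNormal (t ∷ k ∷ bits ∷ []) ⇔ Balanced k t c)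
    (sum<-bits t) (SimpNormal⇔Balanced t k bits)

unbalancedAt : ℕ → ℕ → ℕ
unbalancedAt n a = 2 * 2 ^ n + 2 ^ (n ∸ a)

n<unbalancedAt : ∀ n a → n < unbalancedAt n a
n<unbalancedAt n a = ≤-trans (n<2^n n) (≤-trans (m≤m+n (2 ^ n) _) (m≤m+n (2 * 2 ^ n) (2 ^ (n ∸ a))))

0<balancedFrom : ∀ k S → 0 < balancedFrom k S
0<balancedFrom k S = m^n>0 2 (suc (k + sum< S (suc k)))

module _ {ι : I → ℕ → ℕ} where

  unbalancedAtʳ : {F G : I → Vec ℕ k → ℕ} → Rec ι F → Rec ι G → Rec ι (λ i v → unbalancedAt (F i v) (G i v))
  unbalancedAtʳ F G = sucʳ sucʳ zeroʳ *ʳ 2^ʳ F +ʳ 2^ʳ (F ∸ʳ G)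

  module _ {P : I → ℕ → ℕ → ℕ} (P′ : Rec ι (λ i v → P i (lookup v 0F) (lookup {n = 2} v 1F))) where

    applyʳ : {F G : I → Vec ℕ k → ℕ} → Rec ι F → Rec ι G → Rec ι (λ i v → P i (F i v) (G i v))
    applyʳ {F = F} {G} F′ G′ = compʳ {Gs = λ i v → F i v ∷ G i v ∷ []} P′ λ { 0F → F′ ; 1F → G′ }

    excessʳ : Fun₁ ι (λ i → Tracking.excess (P i))
    excessʳ = fun₁ (maxʳ
      ((sucʳ zeroʳ ∸ʳ (sucʳ zeroʳ ∸ʳ applyʳ (arg 1F) (arg 0F))) *ʳ 2^ʳ (arg 1F ∸ʳ arg 0F))
      (sucʳ arg 0F))

    onesʳ : Fun₁ ι (λ i → Tracking.ones (P i))
    onesʳ = fun₁ (⌊ sucʳ arg 0F /2⌋ʳ ⊔ʳ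
      maxʳ ((arg 1F ∸ʳ 2^ʳ arg 0F) ⊓ʳ (2^ʳ arg 0F +ʳ excessʳ $ʳ arg 0F)) (arg 0F))

    bitsʳ : Fun₁ ι (λ i → toℕ ∘ Tracking.bits (P i))
    bitsʳ = fun₁ (Rec-cong (λ i v → sym (Tracking.toℕ-bits (P i) (lookup v 0F)))
      (onesʳ $ʳ sucʳ arg 0F ∸ʳ onesʳ $ʳ arg 0F))

module _ {Δ : List Sort} (θ : Tuple (num ∷ num ∷ Δ) → Set)
         (A : BoundedFormula (num ∷ num ∷ Δ)) (θ⇔A : ∀ x → θ x ⇔ ⟦ A ⟧ᵇ x) where

  private
    P : Instance Δ → ℕ → ℕ → ℕ
    P (x , _) n a = falsity A (n ∷ a ∷ x)

    θ⇒P≡0 : ∀ x n a → θ (n ∷ a ∷ proj₁ x) → P x n a ≡ 0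
    θ⇒P≡0 x n a = Equivalence.to (falsity-correct A _) ∘ Equivalence.to (θ⇔A _)

    P≡0⇒θ : ∀ x n a → P x n a ≡ 0 → θ (n ∷ a ∷ proj₁ x)
    P≡0⇒θ x n a = Equivalence.from (θ⇔A _) ∘ Equivalence.from (falsity-correct A _)

    ζ : Tuple (num ∷ num ∷ bin ∷ []) → Set
    ζ = matrixOf SimpNormal

    Pʳ : Rec instanceOracle (λ i v → P i (lookup v 0F) (lookup {n = 2} v 1F))
    Pʳ = falsityʳ ⟪ oracleʳ ⟫ {2} {w = λ i v → lookup v} arg A

    sequence : Instance Δ → Tuple (bin ∷ [])
    sequence x = Tracking.bits (P x) ∷ []

    sequenceʳ : Fun₁ instanceOracle (encode ∘ sequence)
    sequenceʳ = bitsʳ {P = P} Pʳ ⊕ʳ fun₁ zeroʳ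

  normality : ComputableMap Δ (bin ∷ [])
  normality = record
    { apply  = λ x → sequence x , sequence-computable x
    ; code   = proj₁ (fun₁-code sequenceʳ)
    ; tracks = proj₂ (fun₁-code sequenceʳ)
    }
    where
    sequence-computable : ∀ x → Computable (encode (sequence x))
    sequence-computable x@(_ , e , e⇓) =
      -- The instance is itself computable, so its program takes the place of the oracle.
      let d , d⇓ = fun₁-code (rebase₁ {ι = λ (_ : ⊤) _ → 0} {h = λ _ → x} (code-fun₁ e λ _ → e⇓) sequenceʳ)
      in d , d⇓ _

  private
    ModulusA ModulusB RecurrenceA RecurrenceB : Solutions Δ
    ModulusA x    = Modulus θ (proj₁ x)
    ModulusB x    = Modulus ζ (sequence x)
    RecurrenceA x = Recurrence θ (proj₁ x)
    RecurrenceB x = Recurrence ζ (sequence x)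

    level : ℕ → ℕ
    level a = 4 * 2 ^ a + 2

    levelʳ : {ι : I → ℕ → ℕ} {F : I → Vec ℕ k → ℕ} → Rec ι F → Rec ι (λ i v → level (F i v))
    levelʳ F = sucʳ sucʳ sucʳ sucʳ zeroʳ *ʳ 2^ʳ F +ʳ sucʳ sucʳ zeroʳ

    unbalanced : ∀ x {n a} → a ≤ n → P x n a ≢ 0 → ¬ ζ (unbalancedAt n a ∷ level a ∷ sequence x)
    unbalanced x {n} {a} a≤n fails normal = Tracking.ones-unbalanced (P x) a≤n fails
      (Equivalence.to (SimpNormal-bits (P x) (level a) (m<n⇒0<n (n<unbalancedAt n a))) normal)

    balanced : ∀ x {k S} → (∀ n a → a ≤ k → S a ≤ n → P x n a ≡ 0) →
               ∀ t → balancedFrom k S ≤ t → ζ (t ∷ k ∷ sequence x)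
    balanced x {k} {S} holds t le = Equivalence.from
      (SimpNormal-bits (P x) k (≤-trans (0<balancedFrom k S) le))
      (eventually-balanced (P x) holds t le)

  modulus-forward : ModulusA ⇝ ModulusB
  modulus-forward = transform (λ (_ , S , _) k → balancedFrom k S)
    (fun₁ (sucʳ sucʳ zeroʳ *ʳ 2^ʳ (arg 0F +ʳ sumʳ (solutionʳ $ʳ arg 0F) (sucʳ arg 0F))))
    (λ (x , S , mod) k t → balanced x {k} (λ n a _ S≤n → θ⇒P≡0 x n a (mod a n S≤n)) t)

  -- A failure at `n` would unbalance the sequence at a length beyond `n`, hence beyond
  -- `S (level a)`. The summand `a` provides `a ≤ n`, without which a failure leaves no trace in
  -- `excess n`.
  modulus-backward : ModulusB ⇝ ModulusA
  modulus-backward = transform (λ (_ , S , _) a → S (level a) + a)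
    (fun₁ (solutionʳ $ʳ levelʳ (arg 0F) +ʳ arg 0F)) holds
    where
    holds : ∀ ((x , S , _) : Solved ModulusB) → ModulusA x (λ a → S (level a) + a)
    holds (x , S , mod) a n le with P x n a ≟ 0
    ... | yes P≡0 = P≡0⇒θ x n a P≡0
    ... | no  P≢0 = contradiction
      (mod (level a) (unbalancedAt n a) (≤-trans (m+n≤o⇒m≤o _ le) (<⇒≤ (n<unbalancedAt n a))))
      (unbalanced x (m+n≤o⇒n≤o (S (level a)) le) P≢0)

  recurrence-forward : RecurrenceA ⇝ RecurrenceB
  recurrence-forward = transform
    -- Asking for failures beyond `m + head α` ensures that the requirement is at most the position.
    (λ (_ , α , _) → cons (level (head α)) (λ m → unbalancedAt (tail α (m + head α)) (head α)))
    (fun₁ (consʳ (levelʳ α₀) (unbalancedAtʳ (solutionʳ $ʳ sucʳ (arg 0F +ʳ α₀)) α₀) (arg 0F)))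
    (λ (x , α , recurs) m → let m+a≤n , ¬θ = recurs (m + head α) in
      ≤-trans (m+n≤o⇒m≤o m m+a≤n) (<⇒≤ (n<unbalancedAt _ (head α))) ,
      unbalanced x (m+n≤o⇒n≤o m m+a≤n) (λ P≡0 → ¬θ (P≡0⇒θ x _ _ P≡0)))
    where
    α₀ : Rec {k = k} (input {A = RecurrenceA}) (λ (_ , α , _) _ → head α)
    α₀ = solutionʳ $ʳ zeroʳ

  module _ (em : ExcludedMiddle 0ℓ) (descending : Descending (quant ∀∞ (matrix θ))) where

    private
      -- The search needs no bound: if requirement k failed only finitely often, then
      -- by descent so would all requirements a ≤ k, and the sequence would
      -- eventually stay within 1 / (k + 1) of balance.
      fails : ∀ ((x , α , _) : Solved RecurrenceB) m → ∃[ j ] 1 ∸ P x (m + j) (head α) ≡ 0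
      fails (x , α , recurs) m with em {∃[ j ] 1 ∸ P x (m + j) (head α) ≡ 0}
      ... | yes found = found
      ... | no  never =
        let t₀≤t , ¬ζ = recurs (balancedFrom K S) in
        contradiction (balanced x S-holds _ t₀≤t) ¬ζ
        where
        K = head α
        holds-K : ∀ n → m ≤ n → θ (n ∷ K ∷ proj₁ x)
        holds-K n m≤n with P x n K ≟ 0
        ... | yes P≡0 = P≡0⇒θ x n K P≡0
        ... | no  P≢0 = contradiction
          (n ∸ m , m≤n⇒m∸n≡0 (subst (λ n → 1 ≤ P x n K) (sym (m+[n∸m]≡n m≤n)) (n≢0⇒n>0 P≢0))) never
        -- Descent supplies a bound for every `a ≤ K`; the default 0 above `K` does not enter
        -- `balancedFrom K S`.
        S : ℕ → ℕ
        S a with a ≤? K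
        ... | yes a≤K = proj₁ (descending x K a a≤K (m , holds-K))
        ... | no  _   = 0
        S-holds : ∀ n a → a ≤ K → S a ≤ n → P x n a ≡ 0
        S-holds n a a≤K S≤n with a ≤? K
        ... | yes p   = θ⇒P≡0 x n a (proj₂ (descending x K a p (m , holds-K)) n S≤n)
        ... | no  a≰K = contradiction a≤K a≰K

      delay : ∀ (s : Solved RecurrenceB) m → ∃[ j ] _
      delay s@(x , α , _) m = let j , j≡0 = fails s m in
        -- The monus turns a failure into a zero, and minimality is what `muʳ` requires.
        least (λ j → 1 ∸ P x (m + j) (head α)) j j≡0

    -- The requirement returned is the level `head α` itself, so only the positions of its failures
    -- are searched for. Excluded middle enters the proof that the search ends, not the program.
    recurrence-backward : RecurrenceB ⇝ RecurrenceA
    recurrence-backward = transform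
      (λ s@(_ , α , _) → cons (head α) (λ m → m + proj₁ (delay s m)))
      (fun₁ (consʳ (solutionʳ $ʳ zeroʳ) (arg 0F +ʳ delayʳ) (arg 0F)))
      (λ s@(x , α , _) m → m≤m+n m _ , λ θ′ →
        contradiction (trans (sym (cong (1 ∸_) (θ⇒P≡0 x _ _ θ′))) (proj₁ (proj₂ (delay s m)))) λ ())
      where
      delayʳ : Rec (input {A = RecurrenceB}) (λ s v → proj₁ (delay s (lookup {n = 2} v 0F)))
      delayʳ = muʳ
        (sucʳ zeroʳ ∸ʳ applyʳ {P = λ (x , _) → P x} (rebase {h = proj₁} instanceʳ Pʳ)
                         (arg 1F +ʳ arg 0F) (solutionʳ $ʳ zeroʳ))
        (λ s v → proj₁ (proj₂ (delay s (lookup v 0F))))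
        (λ s v → proj₂ (proj₂ (delay s (lookup v 0F))))

    normality-reduces : ∀∀∞-formula θ ≤dm SimpNormal
    normality-reduces = normality ,
      reduces normality (modulus-represents θ proj₁ oracleʳ) (modulus-represents ζ sequence sequenceʳ)
        modulus-forward modulus-backward ,
      reduces normality (recurrence-represents θ proj₁ oracleʳ) (recurrence-represents ζ sequence sequenceʳ)
        recurrence-forward recurrence-backward

-- Dicompleteness

mainTheorem8 : ExcludedMiddle 0ℓ → ∀↓∀∞-Dicomplete SimpNormal
mainTheorem8 em = _ , SimpNormal , (SimpNormal-Is∀↓∀∞ , complete) , equivalent , equivalent
  where
  complete : ∀ {Δ} (χ : ∀∀∞-Formula Δ) → Is∀↓∀∞ χ → χ ≤dm SimpNormal
  complete (quant .∀′ (quant .∀∞ (matrix θ))) ((A , θ⇔A) , descending) =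
    normality-reduces θ A θ⇔A em descending
  equivalent : SimpNormal ≤dm SimpNormal
  -- Completeness applied to `SimpNormal` itself takes the place of an identity reduction.
  equivalent = complete SimpNormal SimpNormal-Is∀↓∀∞
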